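{- Let $Av(B)$ be a wreath-closed permutation class (i.e. $B$ consists only of simple permutations). Then $Av(B)$ contains arbitrarily long proper pin-permutations if and only if there exist words of arbitrary length on the alphabet $\{L,R,U,D\}$ having no factor in the set $\bigcup_{\pi\in B}E(\pi)\cup\{LL,LR,RR,RL,UU,UD,DD,DU\}$.
   Context: Permutations of length $n$ are bijections of $\{1,\dots,n\}$, identified with their diagrams $\{(i,\sigma(i))\}$. $\pi\le\sigma$ means some subsequence of $\sigma$ is order isomorphic to $\pi$; $Av(B)$ is the set of permutations containing no element of $B$. A permutation of length $n$ is simple if no set of $l$ consecutive positions ($2\le l\le n-1$) has values forming a set of consecutive integers. Pins are points of $\mathbb{Z}^2$. A pin $p$ separates a set $P$ from a set $Q$ horizontally (resp. vertically) if the horizontal (resp. vertical) line through $p$ has $P$ strictly on one side and $Q$ strictly on the other. A pin sequence is a sequence $(p_1,\dots,p_k)$ of pins, no two in a common row or column, such that for every $i\ge2$, $p_i$ lies outside the bounding box of $\{p_1,\dots,p_{i-1}\}$ and either $p_i$ separates $p_{i-1}$ from $\{p_1,\dots,p_{i-2}\}$, or $p_i$ is independent from $\{p_1,\dots,p_{i-1}\}$ (does not separate it into two nonempty sets). A pin representation of $\sigma$ is a pin sequence order isomorphic to the diagram of $\sigma$. It is proper if every $p_i$ with $i\ge3$ separates $p_{i-1}$ from $\{p_1,\dots,p_{i-2}\}$. A proper pin-permutation is a permutation admitting a proper pin representation. Pin words are words on $\{1,2,3,4,U,D,L,R\}$ obtained as follows: given a pin representation $(p_1,\dots,p_n)$,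 choose an origin $p_0$ such that $(p_0,\dots,p_n)$ is a pin sequence, and encode each $p_i$, $i\ge1$: $U$ (resp. $D,L,R$) if $p_i$ separates $p_{i-1}$ from $\{p_0,\dots,p_{i-2}\}$ and lies above (resp. below, left of, right of) the bounding box of $\{p_0,\dots,p_{i-1}\}$; $1$ (resp. $2,3,4$) if $p_i$ is independent from $\{p_0,\dots,p_{i-1}\}$ and lies in the up-right (resp. up-left, bottom-left, bottom-right) corner region of that bounding box. Such a word corresponds to the permutation $\sigma$. Letters $1,2,3,4$ are numerals, $U,D,L,R$ directions. A strict pin word has length $\ge2$, a numeral first, then only directions; a quasi-strict pin word has length $\ge2$, two numerals first, then only directions. Let $\mathcal{SP}$ be the set of words consisting of a numeral followed by a nonempty word over $\{L,R,U,D\}$ alternating between letters of $\{L,R\}$ and $\{U,D\}$; let $M$ be the set of words of length $\ge3$ over $\{L,R,U,D\}$ alternating between $\{L,R\}$ and $\{U,D\}$. Define $\phi:\mathcal{SP}\to M$ by $\phi(u'u'')=\varphi(u')u''$ for $|u'|=2$ with $\varphi$: $1R\mapsto RUR$, $2R\mapsto LUR$, $3R\mapsto LDR$, $4R\mapsto RDR$, $1L\mapsto RUL$, $2L\mapsto LUL$, $3L\mapsto LDL$, $4L\mapsto RDL$, $1U\mapsto URU$, $2U\mapsto ULU$, $3U\mapsto DLU$, $4U\mapsto DRU$, $1D\mapsto URD$, $2D\mapsto ULD$, $3D\mapsto DLD$, $4D\mapsto DRD$; for single numerals $\phi(1)=\{UR,RU\}$, $\phi(2)=\{UL,LU\}$,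 $\phi(3)=\{DL,LD\}$, $\phi(4)=\{RD,DR\}$. For a simple permutation $\pi$, $E(\pi)$ is the set of words $\phi(u)$ for $u$ a strict pin word corresponding to $\pi$, together with the words $v\in M$ of the form $x\,\phi(u_2\cdots u_{|u|})$ with $u$ a quasi-strict pin word corresponding to $\pi$ and $x\in\{LU,LD,RU,RD,UL,UR,DL,DR\}$. A factor is a contiguous subword.
   Formalization: It is additionally assumed that Av(B) is nonempty, i.e. the one-point permutation (vacuously simple) is not in B; for B = {1} the class is empty and E(1) is empty, so the equivalence as worded fails. -}

module Defs where

open import Data.Fin as Fin using (Fin; suc; toℕ)
open import Data.Fin.Permutation using (Permutation; Permutation′; _⟨$⟩ʳ_)
open import Data.Integer as ℤ using (ℤ; +_)
open import Data.List using (List; []; _∷_; _++_; map; drop; length; lookup)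
open import Data.List.Membership.Propositional using (_∈_)
open import Data.List.Relation.Binary.Infix.Heterogeneous using (Infix)
open import Data.List.Relation.Unary.Linked using (Linked)
open import Data.Nat as ℕ using (ℕ; suc)
open import Data.Product using (_×_; _,_; proj₁; proj₂; ∃; ∃₂)
open import Data.Sum using (_⊎_)
import Data.Vec.Functional as Vector
open import Function.Bundles using (_⇔_)
open import Level using (Level; 0ℓ)
open import Relation.Binary.Core using (Rel; _Preserves_⟶_)
open import Relation.Binary.PropositionalEquality using (_≡_; _≢_)
open import Relation.Nullary using (¬_)
open import Relation.Unary using (Pred; _⊆_; _∪_; _≬_; _≐_)

private
  variable
    ℓ : Level
    k n : ℕ

------------------------------------------------------------------------
-- Permutations

-- Lengths are at least 1; positions and values are numbered from 0.
-- A `Pred Perm` is not required to respect pointwise equality: `Av` and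
-- `E` only inspect the values of a permutation.
Perm : Set
Perm = ∃ λ n → Permutation′ (suc n)

∣_∣ : Perm → ℕ
∣ n , _ ∣ = suc n

_at_ : (σ : Perm) → Fin ∣ σ ∣ → Fin ∣ σ ∣
(_ , σ) at i = σ ⟨$⟩ʳ i

infix 4 _≼_
_≼_ : Rel Perm 0ℓ
π ≼ σ = ∃ λ (f : Fin ∣ π ∣ → Fin ∣ σ ∣) →
  f Preserves Fin._<_ ⟶ Fin._<_ ×
  (∀ i j → (π at i) Fin.< (π at j) ⇔ (σ at f i) Fin.< (σ at f j))

Av : Pred Perm ℓ → Pred Perm ℓ
Av B σ = ∀ π → B π → ¬ (π ≼ σ)

[_,_⟩ : ℕ → ℕ → Pred (Fin n) 0ℓ
[ a , b ⟩ i = a ℕ.≤ toℕ i × toℕ i ℕ.< b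

Image : (σ : Perm) → Pred (Fin ∣ σ ∣) 0ℓ → Pred (Fin ∣ σ ∣) 0ℓ
Image σ P v = ∃ λ i → P i × (σ at i) ≡ v

-- Vacuously true of the one-point permutation; a class Av(B) with B ⊆ Simple
-- is nonempty exactly when that permutation is not in B.
Simple : Pred Perm 0ℓ
Simple σ = ∀ a l → 2 ℕ.≤ l → l ℕ.< ∣ σ ∣ → a ℕ.+ l ℕ.≤ ∣ σ ∣ →
  ¬ (∃₂ λ b c → Image σ [ a , a ℕ.+ l ⟩ ≐ [ b , c ⟩)

------------------------------------------------------------------------
-- Pins

Pin : Set
Pin = ℤ × ℤ

x y : Pin → ℤ
x = proj₁
y = proj₂

data Direction : Set where
  U D L R : Direction

-- `Side d p` is the open half-plane on the d-side of the line through p.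
Side : Direction → Pin → Pred Pin 0ℓ
Side U p q = y p ℤ.< y q
Side D p q = y q ℤ.< y p
Side L p q = x q ℤ.< x p
Side R p q = x p ℤ.< x q

SeparatesHorizontally SeparatesVertically Separates :
  Pin → Pred Pin 0ℓ → Pred Pin 0ℓ → Set
SeparatesHorizontally p P Q =
  (P ⊆ Side U p × Q ⊆ Side D p) ⊎ (P ⊆ Side D p × Q ⊆ Side U p)
SeparatesVertically p P Q =
  (P ⊆ Side L p × Q ⊆ Side R p) ⊎ (P ⊆ Side R p × Q ⊆ Side L p)
Separates p P Q = SeparatesHorizontally p P Q ⊎ SeparatesVertically p P Q

-- If a line through p separates P into two nonempty sets, these sets can
-- only be the parts of P on the two sides of the line.
Independent : Pin → Pred Pin 0ℓ → Set
Independent p P = ¬ (SplitAlong U D ⊎ SplitAlong L R)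
  where
  SplitAlong : Direction → Direction → Set
  SplitAlong d e = P ⊆ Side d p ∪ Side e p × P ≬ Side d p × P ≬ Side e p

BoundingBox : Pred Pin 0ℓ → Pred Pin 0ℓ
BoundingBox P q =
  (∃ λ a → P a × x a ℤ.≤ x q) × (∃ λ a → P a × x q ℤ.≤ x a) ×
  (∃ λ a → P a × y a ℤ.≤ y q) × (∃ λ a → P a × y q ℤ.≤ y a)

LiesTo : Direction → Pin → Pred Pin 0ℓ → Set
LiesTo d p P = ∀ {q} → BoundingBox P q → Side d q p

Before Previous BeforePrevious : (Fin k → Pin) → Fin k → Pred Pin 0ℓ
Before         p i q = ∃ λ j → toℕ j ℕ.< toℕ i × p j ≡ q
Previous       p i q = ∃ λ j → suc (toℕ j) ≡ toℕ i × p j ≡ q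
BeforePrevious p i q = ∃ λ j → suc (toℕ j) ℕ.< toℕ i × p j ≡ q

SeparatesPrevious : (Fin k → Pin) → Fin k → Set
SeparatesPrevious p i = Separates (p i) (Previous p i) (BeforePrevious p i)

IsPinSequence : Pred (Fin k → Pin) 0ℓ
IsPinSequence p =
  (∀ i j → i ≢ j → x (p i) ≢ x (p j) × y (p i) ≢ y (p j)) ×
  (∀ i → 1 ℕ.≤ toℕ i →
    ¬ BoundingBox (Before p i) (p i) ×
    (SeparatesPrevious p i ⊎ Independent (p i) (Before p i)))

IsProper : Pred (Fin k → Pin) 0ℓ
IsProper p = ∀ i → 2 ℕ.≤ toℕ i → SeparatesPrevious p i

diagram : (σ : Perm) → Fin ∣ σ ∣ → Pin
diagram σ i = + toℕ i , + toℕ (σ at i)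

OrderIsomorphic : (Fin k → Pin) → (Fin n → Pin) → Set
OrderIsomorphic {k} {n} p q = ∃ λ (τ : Permutation k n) → ∀ i j →
  (x (p i) ℤ.< x (p j) ⇔ x (q (τ ⟨$⟩ʳ i)) ℤ.< x (q (τ ⟨$⟩ʳ j))) ×
  (y (p i) ℤ.< y (p j) ⇔ y (q (τ ⟨$⟩ʳ i)) ℤ.< y (q (τ ⟨$⟩ʳ j)))

IsPinRepresentation : (Fin k → Pin) → Perm → Set
IsPinRepresentation p σ = IsPinSequence p × OrderIsomorphic p (diagram σ)

ProperPinPermutation : Pred Perm 0ℓ
ProperPinPermutation σ =
  ∃ λ (p : Fin ∣ σ ∣ → Pin) → IsPinRepresentation p σ × IsProper p

------------------------------------------------------------------------
-- Pin words

data Numeral : Set where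
  q1 q2 q3 q4 : Numeral

data Letter : Set where
  num : Numeral → Letter
  dir : Direction → Letter

Word PinWord : Set
Word    = List Direction
PinWord = List Letter

quadrant : Numeral → Direction × Direction
quadrant q1 = U , R
quadrant q2 = U , L
quadrant q3 = D , L
quadrant q4 = D , R

-- Here p starts with the origin.  The bound in the `dir` case keeps the
-- first pin after the origin from being encoded by a direction, since it
-- separates the origin from the empty set vacuously.
Encodes : Letter → (Fin k → Pin) → Fin k → Set
Encodes (dir d) p i =
  2 ℕ.≤ toℕ i × SeparatesPrevious p i × LiesTo d (p i) (Before p i)
Encodes (num m) p i =
  Independent (p i) (Before p i) ×
  LiesTo (proj₁ (quadrant m)) (p i) (Before p i) ×
  LiesTo (proj₂ (quadrant m)) (p i) (Before p i)

CorrespondsTo : PinWord → Perm → Set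
CorrespondsTo u σ = ∃₂ λ (p₀ : Pin) (p : Fin (length u) → Pin) →
  IsPinRepresentation p σ ×
  IsPinSequence (p₀ Vector.∷ p) ×
  (∀ i → Encodes (lookup u i) (p₀ Vector.∷ p) (suc i))

data Strict : Pred PinWord 0ℓ where
  strict : ∀ m d (w : Word) → Strict (num m ∷ map dir (d ∷ w))

data QuasiStrict : Pred PinWord 0ℓ where
  quasiStrict : ∀ m m′ (w : Word) →
    QuasiStrict (num m ∷ num m′ ∷ map dir w)

------------------------------------------------------------------------
-- The map φ

data Axis : Set where
  horizontal vertical : Axis

axis : Direction → Axis
axis U = vertical
axis D = vertical
axis L = horizontal
axis R = horizontal

Alternating : Pred Word 0ℓ
Alternating = Linked (λ d e → axis d ≢ axis e)

M : Pred Word 0ℓ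
M w = 3 ℕ.≤ length w × Alternating w

φ₁ : Numeral → List Word
φ₁ q1 = (U ∷ R ∷ []) ∷ (R ∷ U ∷ []) ∷ []
φ₁ q2 = (U ∷ L ∷ []) ∷ (L ∷ U ∷ []) ∷ []
φ₁ q3 = (D ∷ L ∷ []) ∷ (L ∷ D ∷ []) ∷ []
φ₁ q4 = (R ∷ D ∷ []) ∷ (D ∷ R ∷ []) ∷ []

φ₂ : Numeral → Direction → Word
φ₂ q1 R = R ∷ U ∷ R ∷ []
φ₂ q2 R = L ∷ U ∷ R ∷ []
φ₂ q3 R = L ∷ D ∷ R ∷ []
φ₂ q4 R = R ∷ D ∷ R ∷ []
φ₂ q1 L = R ∷ U ∷ L ∷ []
φ₂ q2 L = L ∷ U ∷ L ∷ []
φ₂ q3 L = L ∷ D ∷ L ∷ []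
φ₂ q4 L = R ∷ D ∷ L ∷ []
φ₂ q1 U = U ∷ R ∷ U ∷ []
φ₂ q2 U = U ∷ L ∷ U ∷ []
φ₂ q3 U = D ∷ L ∷ U ∷ []
φ₂ q4 U = D ∷ R ∷ U ∷ []
φ₂ q1 D = U ∷ R ∷ D ∷ []
φ₂ q2 D = U ∷ L ∷ D ∷ []
φ₂ q3 D = D ∷ L ∷ D ∷ []
φ₂ q4 D = D ∷ R ∷ D ∷ []

-- `φ u v` means that v is φ(u), or an element of φ(u) when u is a single
-- numeral; φ is undefined on pin words of any other shape.
data φ : PinWord → Word → Set where
  single : ∀ {m v} → v ∈ φ₁ m → φ (num m ∷ []) v
  long   : ∀ {m d w} → Alternating (d ∷ w) →
           φ (num m ∷ map dir (d ∷ w)) (φ₂ m d ++ w)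

turns : List Word
turns = (L ∷ U ∷ []) ∷ (L ∷ D ∷ []) ∷ (R ∷ U ∷ []) ∷ (R ∷ D ∷ [])
      ∷ (U ∷ L ∷ []) ∷ (U ∷ R ∷ []) ∷ (D ∷ L ∷ []) ∷ (D ∷ R ∷ []) ∷ []

E : Perm → Pred Word 0ℓ
E π v =
  (∃ λ u → Strict u × CorrespondsTo u π × φ u v) ⊎
  (M v × ∃ λ u → QuasiStrict u × CorrespondsTo u π ×
    ∃₂ λ t w → t ∈ turns × φ (drop 1 u) w × v ≡ t ++ w)

------------------------------------------------------------------------
-- Factors and unboundedness

Factor : Rel Word 0ℓ
Factor = Infix _≡_

nonTurns : List Word
nonTurns = (L ∷ L ∷ []) ∷ (L ∷ R ∷ []) ∷ (R ∷ R ∷ []) ∷ (R ∷ L ∷ [])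
         ∷ (U ∷ U ∷ []) ∷ (U ∷ D ∷ []) ∷ (D ∷ D ∷ []) ∷ (D ∷ U ∷ []) ∷ []

Forbidden : Pred Perm ℓ → Pred Word ℓ
Forbidden B v = (∃ λ π → B π × E π v) ⊎ v ∈ nonTurns

HasNoFactorIn : Pred Word ℓ → Pred Word ℓ
HasNoFactorIn F w = ∀ v → F v → ¬ Factor v w

ArbitrarilyLong : {A : Set} → (A → ℕ) → Pred A ℓ → Set ℓ
ArbitrarilyLong size P = ∀ N → ∃ λ a → N ℕ.≤ size a × P a

{-# OPTIONS --safe #-}
module Submission where

-- The relative order of the pins of a proper pin sequence is determined by
-- their directions: each pin is extreme in its own direction and cuts the
-- previous pin from all others along the axis of the previous direction.  The
-- map φ turns a leading numeral into two directions, so a strict word u encodes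
-- the pins of a factor φ(u) of a direction word as seen from any earlier origin.
-- In a quasi-strict word the first pin is indistinguishable from an origin of
-- the others, so it can be any earlier pin.  Hence an occurrence of a factor in
-- E(π) yields an occurrence of π.
--
-- Conversely, take an occurrence of a simple π in the pins of a word and the
-- last maximal run of consecutive pins that it uses.  The pins used before that
-- run lie on the same sides of each pin of the run, so they form an interval of
-- π and there is at most one of them: π is encoded by a strict or a quasi-strict
-- word whose image is a factor of the given word.

open import Defs
open import Data.Fin as Fin using (Fin; zero; suc; toℕ; fromℕ<; inject₁)
import Data.Fin.Properties as Finₚ
open import Data.Fin.Permutation
  using (Permutation′; permutation; flip; _∘ₚ_; _⟨$⟩ʳ_; _⟨$⟩ˡ_; inverseˡ; inverseʳ)
open import Data.Fin.Subset using (Subset; _∈_) renaming (∣_∣ to card)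
import Data.Fin.Subset.Properties as Subsetₚ
open import Data.Integer as ℤ using (ℤ; +_; -_)
import Data.Integer.Properties as ℤₚ
open import Data.List using ([]; _∷_; _++_; map; drop; length; lookup; applyUpTo; tabulate)
open import Data.List.Membership.Propositional using () renaming (_∈_ to _∈ₗ_)
open import Data.List.Properties using (length-map; length-tabulate; length-applyUpTo)
open import Data.List.Relation.Binary.Infix.Heterogeneous using (here; there)
open import Data.List.Relation.Binary.Prefix.Heterogeneous using (Prefix; []; _∷_)
open import Data.List.Relation.Unary.Any using (here; there)
open import Data.List.Relation.Unary.Linked using ([-]; _∷_)
import Data.List.Relation.Unary.Linked.Properties as Linkedₚ
open import Data.Nat as ℕ using (ℕ; zero; suc; z≤n; s≤s)
import Data.Nat.Properties as ℕₚ
open import Data.Product using (_×_; _,_; proj₁; proj₂; ∃; ∃₂; swap; map₁; map₂)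
open import Data.Sum using (_⊎_; inj₁; inj₂)
import Data.Vec as Vec
import Data.Vec.Functional as Vector
import Data.Vec.Properties as Vecₚ
open import Function using (_∘_; _⇔_; mk⇔; Equivalence; Injective)
open import Level using (Level; 0ℓ)
open import Relation.Binary.Definitions using (tri<; tri≈; tri>)
open import Relation.Binary.PropositionalEquality
open import Relation.Nullary using (¬_; Dec; yes; no; does; contradiction)
open import Relation.Nullary.Decidable using (_×-dec_; ¬?; decidable-stable; dec-true)
open import Relation.Unary using (Pred; Decidable; Satisfiable; _∩_; _⊆_; _≐_)

private
  variable
    k l n : ℕ
    d e : Direction
    o p q p′ q′ z : Pin
    m : Numeral
    u : PinWord
    v w : Word

-- Directions, axes and half-planes.

opp : Direction → Direction
opp U = D
opp D = U
opp L = R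
opp R = L

coordinate : Axis → Pin → ℤ
coordinate horizontal = x
coordinate vertical   = y

side-trans : ∀ d → Side d p q → Side d q z → Side d p z
side-trans U a b = ℤₚ.<-trans a b
side-trans D a b = ℤₚ.<-trans b a
side-trans L a b = ℤₚ.<-trans b a
side-trans R a b = ℤₚ.<-trans a b

side-irrefl : ∀ d → ¬ Side d p p
side-irrefl U = ℤₚ.<-irrefl refl
side-irrefl D = ℤₚ.<-irrefl refl
side-irrefl L = ℤₚ.<-irrefl refl
side-irrefl R = ℤₚ.<-irrefl refl

side-asym : ∀ d → Side d p q → ¬ Side d q p
side-asym d a b = side-irrefl d (side-trans d a b)

side-opp : ∀ d → Side (opp d) p q → Side d q p
side-opp U a = a
side-opp D a = a
side-opp L a = a
side-opp R a = a

opp-side : ∀ d → Side d q p → Side (opp d) p q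
opp-side U a = a
opp-side D a = a
opp-side L a = a
opp-side R a = a

side? : ∀ d p q → Dec (Side d p q)
side? U p q = y p ℤₚ.<? y q
side? D p q = y q ℤₚ.<? y p
side? L p q = x q ℤₚ.<? x p
side? R p q = x p ℤₚ.<? x q

axis-opp : ∀ d → axis (opp d) ≡ axis d
axis-opp U = refl
axis-opp D = refl
axis-opp L = refl
axis-opp R = refl

same-axis : ∀ d e → axis d ≡ axis e → e ≡ d ⊎ e ≡ opp d
same-axis U U _ = inj₁ refl
same-axis U D _ = inj₂ refl
same-axis D U _ = inj₂ refl
same-axis D D _ = inj₁ refl
same-axis L L _ = inj₁ refl
same-axis L R _ = inj₂ refl
same-axis R L _ = inj₂ refl
same-axis R R _ = inj₁ refl

_≟ₐ_ : (a b : Axis) → Dec (a ≡ b)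
horizontal ≟ₐ horizontal = yes refl
horizontal ≟ₐ vertical   = no λ ()
vertical   ≟ₐ horizontal = no λ ()
vertical   ≟ₐ vertical   = yes refl

third-axis : ∀ {a b c : Axis} → a ≢ b → c ≢ b → a ≡ c
third-axis {horizontal} {_}          {horizontal} _ _ = refl
third-axis {vertical}   {_}          {vertical}   _ _ = refl
third-axis {horizontal} {horizontal} {vertical}   f _ = contradiction refl f
third-axis {horizontal} {vertical}   {vertical}   _ g = contradiction refl g
third-axis {vertical}   {horizontal} {horizontal} _ g = contradiction refl g
third-axis {vertical}   {vertical}   {horizontal} f _ = contradiction refl f

side-unique : ∀ d e → axis d ≡ axis e → Side d p q → Side e p q → d ≡ e
side-unique d e d∥e s t with same-axis d e d∥e
... | inj₁ refl = refl
... | inj₂ refl = contradiction (side-opp d t) (side-asym d s)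

side≢ : ∀ d → Side d p q → coordinate (axis d) p ≢ coordinate (axis d) q
side≢ U s eq = ℤₚ.<-irrefl eq s
side≢ D s eq = ℤₚ.<-irrefl (sym eq) s
side≢ L s eq = ℤₚ.<-irrefl (sym eq) s
side≢ R s eq = ℤₚ.<-irrefl eq s

-- Relative order of pins.

Apart : Pin → Pin → Set
Apart p q = x p ≢ x q × y p ≢ y q

both-axes : (F : Axis → Set) → axis d ≢ axis e → F (axis d) → F (axis e) → F horizontal × F vertical
both-axes {d} {e} F d∦e a b with axis d | axis e
... | horizontal | horizontal = contradiction refl d∦e
... | horizontal | vertical   = a , b
... | vertical   | horizontal = b , a
... | vertical   | vertical   = contradiction refl d∦e

apart : axis d ≢ axis e → Side d p q → Side e p q → Apart p q
apart {d} {e} {p} {q} d∦e s t =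
  both-axes {d} {e} (λ a → coordinate a p ≢ coordinate a q) d∦e (side≢ d s) (side≢ e t)

apart-sym : Apart p q → Apart q p
apart-sym (a , b) = a ∘ sym , b ∘ sym

AgreeAlong : Axis → (p q p′ q′ : Pin) → Set
AgreeAlong a p q p′ q′ =
  coordinate a p ℤ.< coordinate a q ⇔ coordinate a p′ ℤ.< coordinate a q′

Agree : (p q p′ q′ : Pin) → Set
Agree p q p′ q′ =
  AgreeAlong horizontal p q p′ q′ × AgreeAlong vertical p q p′ q′

agree-along : ∀ d → Side d p q → Side d p′ q′ →
  AgreeAlong (axis d) p q p′ q′ × AgreeAlong (axis d) q p q′ p′
agree-along U s t = mk⇔ (λ _ → t) (λ _ → s) ,
  mk⇔ (contradiction s ∘ ℤₚ.<-asym) (contradiction t ∘ ℤₚ.<-asym)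
agree-along D s t = mk⇔ (contradiction s ∘ ℤₚ.<-asym) (contradiction t ∘ ℤₚ.<-asym) ,
  mk⇔ (λ _ → t) (λ _ → s)
agree-along L s t = mk⇔ (contradiction s ∘ ℤₚ.<-asym) (contradiction t ∘ ℤₚ.<-asym) ,
  mk⇔ (λ _ → t) (λ _ → s)
agree-along R s t = mk⇔ (λ _ → t) (λ _ → s) ,
  mk⇔ (contradiction s ∘ ℤₚ.<-asym) (contradiction t ∘ ℤₚ.<-asym)

-- Two nonparallel directions cover both axes, so the sides in them decide the whole order of a
-- pair. The pair is returned in both orientations because `SameOrder` ranges over ordered pairs.
agree : axis d ≢ axis e → Side d p q → Side d p′ q′ → Side e p q → Side e p′ q′ →
  Agree p q p′ q′ × Agree q p q′ p′
agree {d} {e} {p} {q} {p′} {q′} d∦e s s′ t t′ =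
  both-axes {d} {e} (λ a → AgreeAlong a p q p′ q′) d∦e
    (proj₁ (agree-along d s s′)) (proj₁ (agree-along e t t′)) ,
  both-axes {d} {e} (λ a → AgreeAlong a q p q′ p′) d∦e
    (proj₂ (agree-along d s s′)) (proj₂ (agree-along e t t′))

agree-sym : Agree p q p′ q′ → Agree p′ q′ p q
agree-sym (a , b) = mk⇔ (from a) (to a) , mk⇔ (from b) (to b)
  where open Equivalence

agree-trans : Agree p q p′ q′ → Agree p′ q′ o z → Agree p q o z
agree-trans (a , b) (c , d) =
  mk⇔ (to c ∘ to a) (from a ∘ from c) , mk⇔ (to d ∘ to b) (from b ∘ from d)
  where open Equivalence

SameOrder : (p q : Fin k → Pin) → Set
SameOrder p q = ∀ i j → Agree (p i) (p j) (q i) (q j)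

sameOrder : {p q : Fin k → Pin} →
  (∀ {j i} → j Fin.< i → Agree (p j) (p i) (q j) (q i) × Agree (p i) (p j) (q i) (q j)) →
  SameOrder p q
sameOrder h i j with Finₚ.<-cmp i j
... | tri< i<j _ _ = proj₁ (h i<j)
... | tri> _ _ j<i = proj₂ (h j<i)
... | tri≈ _ refl _ =
  mk⇔ (contradiction refl ∘ ℤₚ.<⇒≢) (contradiction refl ∘ ℤₚ.<⇒≢) ,
  mk⇔ (contradiction refl ∘ ℤₚ.<⇒≢) (contradiction refl ∘ ℤₚ.<⇒≢)

Distinct : (Fin k → Pin) → Set
Distinct p = ∀ i j → i ≢ j → Apart (p i) (p j)

distinct : {p : Fin k → Pin} → (∀ {j i} → j Fin.< i → Apart (p j) (p i)) → Distinct p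
distinct h i j i≢j with Finₚ.<-cmp i j
... | tri< i<j _ _ = h i<j
... | tri> _ _ j<i = apart-sym (h j<i)
... | tri≈ _ i≡j _ = contradiction i≡j i≢j

-- Separation and bounding boxes.

separates⇒ : ∀ {P Q} → Separates p P Q → ∃ λ e → P ⊆ Side e p × Q ⊆ Side (opp e) p
separates⇒ (inj₁ (inj₁ s)) = U , s
separates⇒ (inj₁ (inj₂ s)) = D , s
separates⇒ (inj₂ (inj₁ s)) = L , s
separates⇒ (inj₂ (inj₂ s)) = R , s

separates⇐ : ∀ {P Q} e → P ⊆ Side e p → Q ⊆ Side (opp e) p → Separates p P Q
separates⇐ U s t = inj₁ (inj₁ (s , t))
separates⇐ D s t = inj₁ (inj₂ (s , t))
separates⇐ L s t = inj₂ (inj₁ (s , t))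
separates⇐ R s t = inj₂ (inj₂ (s , t))

∈⇒∈box : ∀ {P : Pred Pin 0ℓ} → P p → BoundingBox P p
∈⇒∈box Pp = (_ , Pp , ℤₚ.≤-refl) , (_ , Pp , ℤₚ.≤-refl) ,
            (_ , Pp , ℤₚ.≤-refl) , (_ , Pp , ℤₚ.≤-refl)

liesTo : ∀ {P} d → (∀ {q} → P q → Side d q p) → LiesTo d p P
liesTo U h (_ , _ , _ , (_ , Pa , q≤a)) = ℤₚ.≤-<-trans q≤a (h Pa)
liesTo D h (_ , _ , (_ , Pa , a≤q) , _) = ℤₚ.<-≤-trans (h Pa) a≤q
liesTo L h ((_ , Pa , a≤q) , _)         = ℤₚ.<-≤-trans (h Pa) a≤q
liesTo R h (_ , (_ , Pa , q≤a) , _)     = ℤₚ.≤-<-trans q≤a (h Pa)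

-- If every direction is blocked by some earlier pin, the four blocking pins are the witnesses that
-- put `q i` into the bounding box. Blocking is decidable by a finite search.
escapes : {q : Fin k → Pin} → ∀ i → ¬ BoundingBox (Before q i) (q i) →
  ∃ λ d → ∀ {j} → j Fin.< i → Side d (q j) (q i)
escapes {q = q} i ∉box = by-cases (beyond L) (beyond R) (beyond D) (beyond U)
  where
  Beyond Blocked : Direction → Set
  Beyond  d = ∀ {j} → j Fin.< i → Side d (q j) (q i)
  Blocked d = ∃ λ j → j Fin.< i × ¬ Side d (q j) (q i)

  beyond : ∀ d → Beyond d ⊎ Blocked d
  beyond d with Finₚ.any? (λ j → (j Finₚ.<? i) ×-dec ¬? (side? d (q j) (q i)))
  ... | yes b = inj₂ b
  ... | no ¬b = inj₁ λ {j} j<i → decidable-stable (side? d (q j) (q i)) λ ¬s → ¬b (j , j<i , ¬s)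

  by-cases : Beyond L ⊎ Blocked L → Beyond R ⊎ Blocked R →
             Beyond D ⊎ Blocked D → Beyond U ⊎ Blocked U → ∃ Beyond
  by-cases (inj₁ b) _ _ _ = L , b
  by-cases _ (inj₁ b) _ _ = R , b
  by-cases _ _ (inj₁ b) _ = D , b
  by-cases _ _ _ (inj₁ b) = U , b
  by-cases (inj₂ (_ , l< , ¬l)) (inj₂ (_ , r< , ¬r)) (inj₂ (_ , d< , ¬d)) (inj₂ (_ , u< , ¬u)) =
    contradiction
      ((_ , (_ , l< , refl) , ℤₚ.≮⇒≥ ¬l) , (_ , (_ , r< , refl) , ℤₚ.≮⇒≥ ¬r) ,
       (_ , (_ , d< , refl) , ℤₚ.≮⇒≥ ¬d) , (_ , (_ , u< , refl) , ℤₚ.≮⇒≥ ¬u))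
      ∉box

-- Pins that follow a direction word.

-- Pin i lies on the sides f(i) and f(i+1) of the origin and of all earlier
-- pins, except that it cuts pin i-1 from them along the axis of f(i).  Thus a
-- direction word of length k+1 describes k pins after an origin.
record Follows (f : ℕ → Direction) (o : Pin) (r : Fin k → Pin) : Set where
  field
    bends    : ∀ {i} → i ℕ.< k → axis (f i) ≢ axis (f (suc i))
    origin₁  : ∀ i → Side (f (toℕ i)) o (r i)
    origin₂  : ∀ i → Side (f (suc (toℕ i))) o (r i)
    outwards : ∀ {j i} → j Fin.< i → Side (f (suc (toℕ i))) (r j) (r i)
    across   : ∀ {j i} → suc (toℕ j) ℕ.< toℕ i → Side (f (toℕ i)) (r j) (r i)
    cuts     : ∀ {j i} → suc (toℕ j) ≡ toℕ i → Side (f (toℕ i)) (r i) (r j)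

  turn : ∀ i → axis (f (toℕ i)) ≢ axis (f (suc (toℕ i)))
  turn i = bends (Finₚ.toℕ<n i)

module _ {f : ℕ → Direction} {r r′ : Fin k → Pin}
         (F : Follows f o r) (F′ : Follows f p r′) where
  private
    module F = Follows F
    module F′ = Follows F′

  -- Every pair is compared along two nonparallel directions that depend on `f` alone. For
  -- consecutive pins the later one lies on the inner side along `f i`, hence the use of `opp`
  -- there.
  follows-unique : SameOrder (o Vector.∷ r) (p Vector.∷ r′)
  follows-unique = sameOrder same
    where
    same : ∀ {j i} → j Fin.< i →
      Agree ((o Vector.∷ r) j) ((o Vector.∷ r) i) ((p Vector.∷ r′) j) ((p Vector.∷ r′) i) ×
      Agree ((o Vector.∷ r) i) ((o Vector.∷ r) j) ((p Vector.∷ r′) i) ((p Vector.∷ r′) j)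
    same {zero}  {suc i} _ =
      agree (F.turn i) (F.origin₁ i) (F′.origin₁ i) (F.origin₂ i) (F′.origin₂ i)
    same {suc j} {suc i} (s≤s j<i) with suc (toℕ j) ℕₚ.≟ toℕ i
    ... | no j+1≢i =
      agree (F.turn i) (F.across j+1<i) (F′.across j+1<i) (F.outwards j<i) (F′.outwards j<i)
      where j+1<i = ℕₚ.≤∧≢⇒< j<i j+1≢i
    ... | yes j+1≡i =
      agree (F.turn i ∘ trans (sym (axis-opp (f (toℕ i)))))
        (opp-side (f (toℕ i)) (F.cuts j+1≡i)) (opp-side (f (toℕ i)) (F′.cuts j+1≡i))
        (F.outwards j<i) (F′.outwards j<i)

follows-apart : {f : ℕ → Direction} {r : Fin k → Pin} → Follows f o r → ∀ i → Apart o (r i)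
follows-apart F i = apart (turn i) (origin₁ i) (origin₂ i)
  where open Follows F

follows-distinct : {f : ℕ → Direction} {r : Fin k → Pin} → Follows f o r → Distinct r
follows-distinct {f = f} {r} F = distinct apart-before
  where
  open Follows F
  apart-before : ∀ {j i} → j Fin.< i → Apart (r j) (r i)
  apart-before {j} {i} j<i with suc (toℕ j) ℕₚ.≟ toℕ i
  ... | no j+1≢i = apart (turn i) (across (ℕₚ.≤∧≢⇒< j<i j+1≢i)) (outwards j<i)
  ... | yes j+1≡i =
    apart (turn i ∘ trans (sym (axis-opp (f (toℕ i)))))
      (opp-side (f (toℕ i)) (cuts j+1≡i)) (outwards j<i)

∷-distinct : {r : Fin k → Pin} → (∀ i → Apart o (r i)) → Distinct r → Distinct (o Vector.∷ r)
∷-distinct {o = o} {r} o≁r r≁r = distinct apart-before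
  where
  apart-before : ∀ {j i} → j Fin.< i → Apart ((o Vector.∷ r) j) ((o Vector.∷ r) i)
  apart-before {zero}  {suc i} _         = o≁r i
  apart-before {suc j} {suc i} (s≤s j<i) = r≁r j i λ { refl → ℕₚ.<-irrefl refl j<i }

-- Conditions between pins pass to any run of consecutive pins; the sides of the origin are supplied
-- afresh because `o` may differ from the origin `p` of the whole sequence. The letters must agree
-- up to `i` equal to `l`, as `l` pins read `l + 1` letters.
follows-segment : ∀ {f g : ℕ → Direction} {r : Fin k → Pin} a {s : Fin l → Fin k} →
  (∀ {i} → i ℕ.≤ l → g i ≡ f (a ℕ.+ i)) → (∀ i → toℕ (s i) ≡ a ℕ.+ toℕ i) →
  (∀ {i} → Side (f (toℕ (s i))) o (r (s i))) →
  (∀ {i} → Side (f (suc (toℕ (s i)))) o (r (s i))) →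
  (∀ {i} → i ℕ.< l → axis (f (a ℕ.+ i)) ≢ axis (f (suc (a ℕ.+ i)))) →
  Follows f p r → Follows g o (r ∘ s)
follows-segment {l = l} {f = f} {g} {r} a {s} g≡f s≡ o₁ o₂ ts F = record
  { bends    = λ {i} i<l → subst₂ (λ d e → axis d ≢ axis e)
      (sym (g≡f (ℕₚ.<⇒≤ i<l)))
      (trans (cong f (sym (ℕₚ.+-suc a i))) (sym (g≡f i<l))) (ts i<l)
  ; origin₁  = λ i → subst (λ d → Side d _ (r (s i))) (f₁ i) o₁
  ; origin₂  = λ i → subst (λ d → Side d _ (r (s i))) (f₂ i) o₂
  ; outwards = λ {j} {i} j<i → subst (λ d → Side d (r (s j)) (r (s i))) (f₂ i)
      (outwards (s-mono j<i))
  ; across   = λ {j} {i} j<i → subst (λ d → Side d (r (s j)) (r (s i))) (f₁ i)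
      (across (subst₂ ℕ._<_ (trans (ℕₚ.+-suc a _) (cong suc (sym (s≡ j)))) (sym (s≡ i)) (ℕₚ.+-monoʳ-< a j<i)))
  ; cuts     = λ {j} {i} j≡i → subst (λ d → Side d (r (s i)) (r (s j))) (f₁ i)
      (cuts (trans (cong suc (s≡ j)) (trans (sym (ℕₚ.+-suc a _)) (trans (cong (a ℕ.+_) j≡i) (sym (s≡ i))))))
  }
  where
  open Follows F
  f₁ : ∀ i → f (toℕ (s i)) ≡ g (toℕ i)
  f₁ i = trans (cong f (s≡ i)) (sym (g≡f (ℕₚ.<⇒≤ (Finₚ.toℕ<n i))))
  f₂ : ∀ i → f (suc (toℕ (s i))) ≡ g (suc (toℕ i))
  f₂ i = trans (cong f (trans (cong suc (s≡ i)) (sym (ℕₚ.+-suc a _)))) (sym (g≡f (Finₚ.toℕ<n i)))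
  s-mono : ∀ {j i} → j Fin.< i → s j Fin.< s i
  s-mono {j} {i} j<i = subst₂ ℕ._<_ (sym (s≡ j)) (sym (s≡ i)) (ℕₚ.+-monoʳ-< a j<i)

-- Encodings as half-plane conditions.

-- `Encodes` without bounding boxes, without its bound on the index, and without independence, which
-- the two sides of a corner imply. In the direction case `e` points from pin `i` to the previous
-- pin; that it is the previous letter has to be proved.
Placed : Letter → (Fin k → Pin) → Fin k → Set
Placed (num m) p i = ∀ {j} → j Fin.< i →
  Side (proj₁ (quadrant m)) (p j) (p i) × Side (proj₂ (quadrant m)) (p j) (p i)
Placed (dir d) p i =
  (∀ {j} → j Fin.< i → Side d (p j) (p i)) ×
  ∃ λ e → (∀ {j} → suc (toℕ j) ≡ toℕ i → Side e (p i) (p j)) ×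
          (∀ {j} → suc (toℕ j) ℕ.< toℕ i → Side e (p j) (p i))

separatesPrevious⇒ : {p : Fin k → Pin} → ∀ i → SeparatesPrevious p i →
  ∃ λ e → (∀ {j} → suc (toℕ j) ≡ toℕ i → Side e (p i) (p j)) ×
          (∀ {j} → suc (toℕ j) ℕ.< toℕ i → Side e (p j) (p i))
separatesPrevious⇒ i s with separates⇒ s
... | e , after , before =
  e , (λ j+1≡i → after (_ , j+1≡i , refl)) , (λ j+1<i → side-opp e (before (_ , j+1<i , refl)))

encodes⇒placed : ∀ u {p : Fin k → Pin} i → Encodes u p i → Placed u p i
encodes⇒placed (num m) i (_ , s , t) j<i =
  s (∈⇒∈box (_ , j<i , refl)) , t (∈⇒∈box (_ , j<i , refl))
encodes⇒placed (dir d) i (_ , sep , s) =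
  (λ j<i → s (∈⇒∈box (_ , j<i , refl))) , separatesPrevious⇒ i sep

placed⇒separates : ∀ {d} {p : Fin k → Pin} i → Placed (dir d) p i → SeparatesPrevious p i
placed⇒separates i (_ , e , after , before) = separates⇐ e
  (λ { (_ , j+1≡i , refl) → after j+1≡i })
  (λ { (_ , j+1<i , refl) → opp-side e (before j+1<i) })

-- All earlier pins lie on one side of each line through `p i`, so the witness of a split on the
-- other side is contradictory.
placed⇒independent : ∀ {m} {p : Fin k → Pin} i → Placed (num m) p i → Independent (p i) (Before p i)
placed⇒independent {m = q1} i pl = λ where
  (inj₁ (_ , (_ , (_ , j<i , refl) , s) , _)) → ℤₚ.<-asym s (proj₁ (pl j<i))
  (inj₂ (_ , _ , (_ , (_ , j<i , refl) , s))) → ℤₚ.<-asym s (proj₂ (pl j<i))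
placed⇒independent {m = q2} i pl = λ where
  (inj₁ (_ , (_ , (_ , j<i , refl) , s) , _)) → ℤₚ.<-asym s (proj₁ (pl j<i))
  (inj₂ (_ , (_ , (_ , j<i , refl) , s) , _)) → ℤₚ.<-asym s (proj₂ (pl j<i))
placed⇒independent {m = q3} i pl = λ where
  (inj₁ (_ , _ , (_ , (_ , j<i , refl) , s))) → ℤₚ.<-asym s (proj₁ (pl j<i))
  (inj₂ (_ , (_ , (_ , j<i , refl) , s) , _)) → ℤₚ.<-asym s (proj₂ (pl j<i))
placed⇒independent {m = q4} i pl = λ where
  (inj₁ (_ , _ , (_ , (_ , j<i , refl) , s))) → ℤₚ.<-asym s (proj₁ (pl j<i))
  (inj₂ (_ , _ , (_ , (_ , j<i , refl) , s))) → ℤₚ.<-asym s (proj₂ (pl j<i))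

liesTo-placed : ∀ d {p : Fin k → Pin} {i} → (∀ {j} → j Fin.< i → Side d (p j) (p i)) →
  LiesTo d (p i) (Before p i)
liesTo-placed d h = liesTo d λ { (_ , j<i , refl) → h j<i }

placed⇒encodes-num : ∀ {m} {p : Fin k → Pin} i → Placed (num m) p i → Encodes (num m) p i
placed⇒encodes-num {m = m} i pl =
  placed⇒independent {m = m} i pl , liesTo-placed _ (proj₁ ∘ pl) , liesTo-placed _ (proj₂ ∘ pl)

placed⇒encodes : ∀ u {p : Fin k → Pin} i → 2 ℕ.≤ toℕ i → Placed u p i → Encodes u p i
placed⇒encodes (num m) i _ pl = placed⇒encodes-num {m = m} i pl
placed⇒encodes (dir d) i 2≤i pl = 2≤i , placed⇒separates i pl , liesTo-placed d (proj₁ pl)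

placed⇒pin : ∀ u {p : Fin k → Pin} i → Placed u p i →
  ¬ BoundingBox (Before p i) (p i) × (SeparatesPrevious p i ⊎ Independent (p i) (Before p i))
placed⇒pin (num m) i pl =
  side-irrefl _ ∘ liesTo-placed _ (proj₁ ∘ pl) , inj₂ (placed⇒independent {m = m} i pl)
placed⇒pin (dir d) i pl =
  side-irrefl d ∘ liesTo-placed d (proj₁ pl) , inj₁ (placed⇒separates i pl)

-- Dropping the first point keeps the letters of later pins. In a quasi-strict word this makes the
-- first pin the origin of the rest.
placed-tail : ∀ u {r : Fin k → Pin} i → Placed u (o Vector.∷ r) (suc i) → Placed u r i
placed-tail (num m) i pl = pl ∘ s≤s
placed-tail (dir d) i (own , e , after , before) =
  own ∘ s≤s , e , after ∘ cong suc , before ∘ s≤s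

-- Numerals as pairs of directions.

-- `quadrant` lists the vertical direction first, whereas a word may meet the two directions in
-- either order.
Corner : Numeral → Direction → Direction → Set
Corner m d e = quadrant m ≡ (d , e) ⊎ quadrant m ≡ (e , d)

corner-unique : ∀ {d e d′ e′} → Corner m d e → Corner m d′ e′ →
  (d ≡ d′ × e ≡ e′) ⊎ (d ≡ e′ × e ≡ d′)
corner-unique (inj₁ a) (inj₁ b) with refl ← trans (sym a) b = inj₁ (refl , refl)
corner-unique (inj₁ a) (inj₂ b) with refl ← trans (sym a) b = inj₂ (refl , refl)
corner-unique (inj₂ a) (inj₁ b) with refl ← trans (sym a) b = inj₂ (refl , refl)
corner-unique (inj₂ a) (inj₂ b) with refl ← trans (sym a) b = inj₁ (refl , refl)

corner : axis d ≢ axis e → ∃ λ m → Corner m d e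
corner {U} {R} _ = q1 , inj₁ refl
corner {R} {U} _ = q1 , inj₂ refl
corner {U} {L} _ = q2 , inj₁ refl
corner {L} {U} _ = q2 , inj₂ refl
corner {D} {L} _ = q3 , inj₁ refl
corner {L} {D} _ = q3 , inj₂ refl
corner {D} {R} _ = q4 , inj₁ refl
corner {R} {D} _ = q4 , inj₂ refl
corner {U} {U} h = contradiction refl h
corner {U} {D} h = contradiction refl h
corner {D} {U} h = contradiction refl h
corner {D} {D} h = contradiction refl h
corner {L} {L} h = contradiction refl h
corner {L} {R} h = contradiction refl h
corner {R} {L} h = contradiction refl h
corner {R} {R} h = contradiction refl h

corner∈φ₁ : Corner m d e → d ∷ e ∷ [] ∈ₗ φ₁ m
corner∈φ₁ {q1} (inj₁ refl) = here refl
corner∈φ₁ {q1} (inj₂ refl) = there (here refl)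
corner∈φ₁ {q2} (inj₁ refl) = here refl
corner∈φ₁ {q2} (inj₂ refl) = there (here refl)
corner∈φ₁ {q3} (inj₁ refl) = here refl
corner∈φ₁ {q3} (inj₂ refl) = there (here refl)
corner∈φ₁ {q4} (inj₁ refl) = there (here refl)
corner∈φ₁ {q4} (inj₂ refl) = here refl

φ₁-corner : v ∈ₗ φ₁ m → ∃₂ λ d e → v ≡ d ∷ e ∷ [] × Corner m d e × axis d ≢ axis e
φ₁-corner {m = q1} (here refl)         = U , R , refl , inj₁ refl , λ ()
φ₁-corner {m = q1} (there (here refl)) = R , U , refl , inj₂ refl , λ ()
φ₁-corner {m = q2} (here refl)         = U , L , refl , inj₁ refl , λ ()
φ₁-corner {m = q2} (there (here refl)) = L , U , refl , inj₂ refl , λ ()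
φ₁-corner {m = q3} (here refl)         = D , L , refl , inj₁ refl , λ ()
φ₁-corner {m = q3} (there (here refl)) = L , D , refl , inj₂ refl , λ ()
φ₁-corner {m = q4} (here refl)         = R , D , refl , inj₂ refl , λ ()
φ₁-corner {m = q4} (there (here refl)) = D , R , refl , inj₁ refl , λ ()

φ₂-corner : ∀ m d → ∃₂ λ a b → φ₂ m d ≡ a ∷ b ∷ d ∷ [] × Corner m a b ×
  axis a ≢ axis b × axis b ≢ axis d
φ₂-corner q1 R = R , U , refl , inj₂ refl , (λ ()) , λ ()
φ₂-corner q2 R = L , U , refl , inj₂ refl , (λ ()) , λ ()
φ₂-corner q3 R = L , D , refl , inj₂ refl , (λ ()) , λ ()
φ₂-corner q4 R = R , D , refl , inj₂ refl , (λ ()) , λ ()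
φ₂-corner q1 L = R , U , refl , inj₂ refl , (λ ()) , λ ()
φ₂-corner q2 L = L , U , refl , inj₂ refl , (λ ()) , λ ()
φ₂-corner q3 L = L , D , refl , inj₂ refl , (λ ()) , λ ()
φ₂-corner q4 L = R , D , refl , inj₂ refl , (λ ()) , λ ()
φ₂-corner q1 U = U , R , refl , inj₁ refl , (λ ()) , λ ()
φ₂-corner q2 U = U , L , refl , inj₁ refl , (λ ()) , λ ()
φ₂-corner q3 U = D , L , refl , inj₁ refl , (λ ()) , λ ()
φ₂-corner q4 U = D , R , refl , inj₁ refl , (λ ()) , λ ()
φ₂-corner q1 D = U , R , refl , inj₁ refl , (λ ()) , λ ()
φ₂-corner q2 D = U , L , refl , inj₁ refl , (λ ()) , λ ()
φ₂-corner q3 D = D , L , refl , inj₁ refl , (λ ()) , λ ()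
φ₂-corner q4 D = D , R , refl , inj₁ refl , (λ ()) , λ ()

-- φ replaces the leading numeral by the two directions spanning its quadrant,
-- ordered so that the result alternates.
φ⇒corner : φ u v → ∃₂ λ m w → ∃₂ λ d e →
  u ≡ num m ∷ map dir w × v ≡ d ∷ e ∷ w × Corner m d e × Alternating v
φ⇒corner (single {m} v∈) with φ₁-corner v∈
... | d , e , refl , c , d∦e = m , [] , d , e , refl , refl , c , d∦e ∷ [-]
φ⇒corner (long {m} {d} {w} alt) with φ₂ m d | φ₂-corner m d
... | _ | a , b , refl , c , a∦b , b∦d =
  m , d ∷ w , a , b , refl , refl , c , a∦b ∷ b∦d ∷ alt

-- Before a direction `g`, only one order of the two corner directions has a second letter
-- transverse to `g`; alternation forces it here and `φ₂` chooses it. For a lone numeral both orders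
-- are in `φ₁`.
corner⇒φ : ∀ {w} → Corner m d e → Alternating (d ∷ e ∷ w) → φ (num m ∷ map dir w) (d ∷ e ∷ w)
corner⇒φ {w = []} c _ = single (corner∈φ₁ c)
corner⇒φ {m} {d} {e} {w = g ∷ w} c (d∦e ∷ e∦g ∷ alt) =
  subst (φ _) (cong (_++ w) φ₂≡) (long alt)
  where
  φ₂≡ : φ₂ m g ≡ d ∷ e ∷ g ∷ []
  φ₂≡ with φ₂ m g | φ₂-corner m g
  ... | _ | a , b , refl , c′ , a∦b , b∦g with corner-unique c c′
  ... | inj₁ (refl , refl) = refl
  ... | inj₂ (refl , refl) = contradiction (third-axis e∦g b∦g) a∦b

-- Letters of a word and the pins they place.

-- Letters beyond the end of a word are junk.
letter : Word → ℕ → Direction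
letter []      _       = U
letter (d ∷ _) zero    = d
letter (_ ∷ w) (suc i) = letter w i

lookup-map-dir : ∀ w (i : Fin (length (map dir w))) → lookup (map dir w) i ≡ dir (letter w (toℕ i))
lookup-map-dir (d ∷ w) zero    = refl
lookup-map-dir (d ∷ w) (suc i) = lookup-map-dir w i

alternating-letters : Alternating v → ∀ i → suc i ℕ.< length v →
  axis (letter v i) ≢ axis (letter v (suc i))
alternating-letters (d∦e ∷ _) zero    _         = d∦e
alternating-letters (_ ∷ alt) (suc i) (s≤s i<n) = alternating-letters alt i i<n
alternating-letters [-]       _       (s≤s ())

corner-sides : Corner m d e →
  Side (proj₁ (quadrant m)) p q × Side (proj₂ (quadrant m)) p q → Side d p q × Side e p q
corner-sides (inj₁ eq) s rewrite eq = s
corner-sides (inj₂ eq) s rewrite eq = swap s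

sides-corner : Corner m d e → Side d p q → Side e p q →
  Side (proj₁ (quadrant m)) p q × Side (proj₂ (quadrant m)) p q
sides-corner (inj₁ eq) s t rewrite eq = s , t
sides-corner (inj₂ eq) s t rewrite eq = t , s

-- A separating pin beyond all earlier ones in direction d separates along the
-- axis other than that of d, as there are pins on both sides of its line.
separation-turns : ∀ d e → Side d q p → Side e p q → Side d o p → Side e o p → axis d ≢ axis e
separation-turns d e q<p p<q o<p o<p′ d∥e with same-axis d e d∥e
... | inj₁ refl = side-asym d q<p p<q
... | inj₂ refl = side-asym d o<p (side-opp d o<p′)

module _ {m : Numeral} {d e : Direction} {w : Word} (c : Corner m d e) where
  private
    u′ : PinWord
    u′ = num m ∷ map dir w
    v′ : Word
    v′ = d ∷ e ∷ w

  -- A letter fixes only the side on which its pin is extreme. What must be added is that the pin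
  -- cuts along the direction of the preceding letter, which is `e≡`.
  placed⇒follows : {r : Fin (length u′) → Pin} → Alternating v′ →
    (∀ i → Placed (lookup u′ i) (o Vector.∷ r) (suc i)) → Follows (letter v′) o r
  placed⇒follows {o} {r} alt placed = record
    { bends    = λ {i} i< → alternating-letters alt i (s≤s (subst (i ℕ.<_) (cong suc (length-map dir w)) i<))
    ; origin₁  = o₁
    ; origin₂  = o₂
    ; outwards = out
    ; across   = λ {j} {i} → acr j i
    ; cuts     = λ {j} {i} → cut j i
    }
    where
    f : ℕ → Direction
    f = letter v′
    placed-dir : ∀ i → Placed (dir (letter w (toℕ i))) (o Vector.∷ r) (suc (suc i))
    placed-dir i = subst (λ l → Placed l (o Vector.∷ r) (suc (suc i))) (lookup-map-dir w i) (placed (suc i))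
    o₂ : ∀ i → Side (f (suc (toℕ i))) o (r i)
    o₂ zero    = proj₂ (corner-sides c (placed zero (s≤s z≤n)))
    o₂ (suc i) = proj₁ (placed-dir i) (s≤s z≤n)
    out : ∀ {j i} → j Fin.< i → Side (f (suc (toℕ i))) (r j) (r i)
    out {j} {suc i} j<i = proj₁ (placed-dir i) (s≤s j<i)
    -- The cutting direction and the preceding letter are both transverse to the pin's own letter,
    -- so they share an axis. They point the same way because the previous pin lies beyond the
    -- origin in both.
    e≡ : ∀ i → proj₁ (proj₂ (placed-dir i)) ≡ f (suc (toℕ i))
    e≡ i with placed-dir i
    ... | own , e′ , after , before = side-unique e′ (f (suc (toℕ i)))
      (third-axis
        (separation-turns g e′ (own (s≤s (s≤s prev≤))) (after (cong suc (cong suc prev≡)))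
          (own (s≤s z≤n)) (before (s≤s (s≤s z≤n))) ∘ sym)
        (alternating-letters alt (suc (toℕ i))
          (s≤s (s≤s (subst (toℕ i ℕ.<_) (length-map dir w) (Finₚ.toℕ<n i))))))
      (side-trans e′ (before (s≤s (s≤s z≤n))) (after (cong suc (cong suc prev≡))))
      (subst (λ n → Side (f (suc n)) o (r prev)) prev≡ (o₂ prev))
      where
      g : Direction
      g = letter w (toℕ i)
      prev : Fin (length u′)
      prev = inject₁ i
      prev≡ : toℕ prev ≡ toℕ i
      prev≡ = Finₚ.toℕ-inject₁ i
      prev≤ : toℕ prev ℕ.≤ toℕ i
      prev≤ = ℕₚ.≤-reflexive prev≡
    o₁ : ∀ i → Side (f (toℕ i)) o (r i)
    o₁ zero    = proj₁ (corner-sides c (placed zero (s≤s z≤n)))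
    o₁ (suc i) = subst (λ e′ → Side e′ o (r (suc i))) (e≡ i)
      (proj₂ (proj₂ (proj₂ (placed-dir i))) (s≤s (s≤s z≤n)))
    acr : ∀ j i → suc (toℕ j) ℕ.< toℕ i → Side (f (toℕ i)) (r j) (r i)
    acr j (suc i) j<i = subst (λ e′ → Side e′ (r j) (r (suc i))) (e≡ i)
      (proj₂ (proj₂ (proj₂ (placed-dir i))) (s≤s j<i))
    cut : ∀ j i → suc (toℕ j) ≡ toℕ i → Side (f (toℕ i)) (r i) (r j)
    cut j (suc i) j≡i = subst (λ e′ → Side e′ (r (suc i)) (r j)) (e≡ i)
      (proj₁ (proj₂ (proj₂ (placed-dir i))) (cong suc j≡i))

  -- A quasi-strict word has two points, the origin and the first pin, before
  -- the pins that follow the letters of v′.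
  follows⇒placed : {r : Fin (length u′) → Pin} →
    Follows (letter v′) o r → Follows (letter v′) p r →
    ∀ i → Placed (lookup u′ i) (p Vector.∷ o Vector.∷ r) (suc (suc i))
  follows⇒placed {o} {p} {r} F G zero = at-corner
    where
    at-corner : Placed (num m) (p Vector.∷ o Vector.∷ r) (suc (suc zero))
    at-corner {zero}        _ = sides-corner c (Follows.origin₁ G zero) (Follows.origin₂ G zero)
    at-corner {suc zero}    _ = sides-corner c (Follows.origin₁ F zero) (Follows.origin₂ F zero)
    at-corner {suc (suc j)} (s≤s (s≤s ()))
  follows⇒placed {o} {p} {r} F G (suc i) rewrite lookup-map-dir w i =
    (λ {j} → own j) , _ , (λ {j} → after j) , (λ {j} → before j)
    where
    own : ∀ j → j Fin.< suc (suc (suc i)) → Side (letter w (toℕ i)) ((p Vector.∷ o Vector.∷ r) j) (r (suc i))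
    own zero          _               = Follows.origin₂ G (suc i)
    own (suc zero)    _               = Follows.origin₂ F (suc i)
    own (suc (suc j)) (s≤s (s≤s j<i)) = Follows.outwards F j<i
    after : ∀ j → suc (toℕ j) ≡ suc (suc (suc (toℕ i))) →
      Side (letter v′ (suc (toℕ i))) (r (suc i)) ((p Vector.∷ o Vector.∷ r) j)
    after zero          ()
    after (suc zero)    ()
    after (suc (suc j)) j≡i = Follows.cuts F (ℕₚ.suc-injective (ℕₚ.suc-injective j≡i))
    before : ∀ j → suc (toℕ j) ℕ.< suc (suc (suc (toℕ i))) →
      Side (letter v′ (suc (toℕ i))) ((p Vector.∷ o Vector.∷ r) j) (r (suc i))
    before zero          _               = Follows.origin₁ G (suc i)
    before (suc zero)    _               = Follows.origin₁ F (suc i)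
    before (suc (suc j)) (s≤s (s≤s j<i)) = Follows.across F j<i

-- Turns, non-turns and positions of factors.

turn⇒pair : v ∈ₗ turns → ∃₂ λ d e → v ≡ d ∷ e ∷ []
turn⇒pair (here refl) = _ , _ , refl
turn⇒pair (there (here refl)) = _ , _ , refl
turn⇒pair (there (there (here refl))) = _ , _ , refl
turn⇒pair (there (there (there (here refl)))) = _ , _ , refl
turn⇒pair (there (there (there (there (here refl))))) = _ , _ , refl
turn⇒pair (there (there (there (there (there (here refl)))))) = _ , _ , refl
turn⇒pair (there (there (there (there (there (there (here refl))))))) = _ , _ , refl
turn⇒pair (there (there (there (there (there (there (there (here refl)))))))) = _ , _ , refl

pair⇒turn : ∀ d e → axis d ≢ axis e → d ∷ e ∷ [] ∈ₗ turns
pair⇒turn L U _ = here refl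
pair⇒turn L D _ = there (here refl)
pair⇒turn R U _ = there (there (here refl))
pair⇒turn R D _ = there (there (there (here refl)))
pair⇒turn U L _ = there (there (there (there (here refl))))
pair⇒turn U R _ = there (there (there (there (there (here refl)))))
pair⇒turn D L _ = there (there (there (there (there (there (here refl))))))
pair⇒turn D R _ = there (there (there (there (there (there (there (here refl)))))))
pair⇒turn L L h = contradiction refl h
pair⇒turn L R h = contradiction refl h
pair⇒turn R R h = contradiction refl h
pair⇒turn R L h = contradiction refl h
pair⇒turn U U h = contradiction refl h
pair⇒turn U D h = contradiction refl h
pair⇒turn D D h = contradiction refl h
pair⇒turn D U h = contradiction refl h

nonTurn⇒pair : v ∈ₗ nonTurns → ∃₂ λ d e → v ≡ d ∷ e ∷ [] × axis d ≡ axis e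
nonTurn⇒pair (here refl) = _ , _ , refl , refl
nonTurn⇒pair (there (here refl)) = _ , _ , refl , refl
nonTurn⇒pair (there (there (here refl))) = _ , _ , refl , refl
nonTurn⇒pair (there (there (there (here refl)))) = _ , _ , refl , refl
nonTurn⇒pair (there (there (there (there (here refl))))) = _ , _ , refl , refl
nonTurn⇒pair (there (there (there (there (there (here refl)))))) = _ , _ , refl , refl
nonTurn⇒pair (there (there (there (there (there (there (here refl))))))) = _ , _ , refl , refl
nonTurn⇒pair (there (there (there (there (there (there (there (here refl)))))))) = _ , _ , refl , refl

pair⇒nonTurn : ∀ d e → axis d ≡ axis e → d ∷ e ∷ [] ∈ₗ nonTurns
pair⇒nonTurn L L _ = here refl
pair⇒nonTurn L R _ = there (here refl)
pair⇒nonTurn R R _ = there (there (here refl))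
pair⇒nonTurn R L _ = there (there (there (here refl)))
pair⇒nonTurn U U _ = there (there (there (there (here refl))))
pair⇒nonTurn U D _ = there (there (there (there (there (here refl)))))
pair⇒nonTurn D D _ = there (there (there (there (there (there (here refl))))))
pair⇒nonTurn D U _ = there (there (there (there (there (there (there (here refl)))))))

prefix-letters : Prefix _≡_ v w →
  length v ℕ.≤ length w × (∀ i → i ℕ.< length v → letter v i ≡ letter w i)
prefix-letters []         = z≤n , λ _ ()
prefix-letters (refl ∷ p) with prefix-letters p
... | n≤ , eq = s≤s n≤ , λ { zero _ → refl ; (suc i) (s≤s i<) → eq i i< }

factor-letters : Factor v w → ∃ λ a →
  a ℕ.+ length v ℕ.≤ length w × (∀ i → i ℕ.< length v → letter v i ≡ letter w (a ℕ.+ i))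
factor-letters (here p)  = 0 , prefix-letters p
factor-letters (there f) with factor-letters f
... | a , a+n≤ , eq = suc a , s≤s a+n≤ , eq

letter-tabulate : (g : Fin n → Direction) → ∀ i → letter (tabulate g) (toℕ i) ≡ g i
letter-tabulate g zero    = refl
letter-tabulate g (suc i) = letter-tabulate (g ∘ suc) i

-- From long proper pin-permutations to words.

embedding : ∀ {π σ} {q : Fin k → Pin} {p : Fin n → Pin} (g : Fin k → Fin n) →
  OrderIsomorphic q (diagram π) → OrderIsomorphic p (diagram σ) → SameOrder q (p ∘ g) → π ≼ σ
embedding {π = π} {σ} g (τ , q≅π) (ρ , p≅σ) q≅pg =
  f , (λ i<j → ℤₚ.drop‿+<+ (to (proj₁ (same _ _)) (ℤ.+<+ i<j))) ,
  λ i j → mk⇔ (λ lt → ℤₚ.drop‿+<+ (to (proj₂ (same i j)) (ℤ.+<+ lt)))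
              (λ lt → ℤₚ.drop‿+<+ (from (proj₂ (same i j)) (ℤ.+<+ lt)))
  where
  open Equivalence
  f : Fin ∣ π ∣ → Fin ∣ σ ∣
  f i = ρ ⟨$⟩ʳ g (τ ⟨$⟩ˡ i)
  same : SameOrder (diagram π) (diagram σ ∘ f)
  same i j = subst₂ (λ i′ j′ → Agree (diagram π i′) (diagram π j′) (diagram σ (f i)) (diagram σ (f j)))
    (inverseʳ τ) (inverseʳ τ)
    (agree-trans (agree-sym (q≅π _ _)) (agree-trans (q≅pg _ _) (p≅σ _ _)))

module _ {p : Fin (3 ℕ.+ k) → Pin} (p-pins : IsPinSequence p) (p-proper : IsProper p) where
  private
    p-placed : ∀ (i : Fin (suc k)) → ∃ λ d → Placed (dir d) p (suc (suc i))
    p-placed i with escapes (suc (suc i)) (proj₁ (proj₂ p-pins (suc (suc i)) (s≤s z≤n)))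
    ... | d , own = d , own , separatesPrevious⇒ (suc (suc i)) (p-proper (suc (suc i)) (s≤s (s≤s z≤n)))

    direction : Fin (suc k) → Direction
    direction i = proj₁ (p-placed i)

    f : ℕ → Direction
    -- Letter `i` is the direction of pin `i + 2`, so the letters `i` and `i + 1` around `r i`
    -- belong to pins `i + 2` and `i + 3`.
    f = letter (tabulate direction)

    -- Pins 1 and 2 have no direction preceding theirs, so the pins follow
    -- their directions only from pin 3 on.
    r : Fin k → Pin
    r i = p (suc (suc (suc i)))

    -- Alternation is not given here but derived: the cutting direction `e₁` of a pin is transverse
    -- to its own direction `d₁`, and it is identified with the direction `d₀` of the previous pin.
    step : ∀ i → axis (f (toℕ i)) ≢ axis (f (suc (toℕ i))) ×
      (∀ {j} → suc (toℕ j) ≡ toℕ (suc (suc (suc i))) → Side (f (toℕ i)) (r i) (p j)) ×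
      (∀ {j} → suc (toℕ j) ℕ.< toℕ (suc (suc (suc i))) → Side (f (toℕ i)) (p j) (r i))
    step i =
      (λ f₁∥f₂ → separation-turns d₁ e₁
        (own (s≤s (s≤s (s≤s prev≤)))) (after prev+1≡) (own (s≤s z≤n)) e₁:first
        (trans (cong axis (sym (letter-tabulate direction (suc i)))) (trans (sym f₁∥f₂) (cong axis (sym e₁≡f₁))))) ,
      (λ j+1≡ → subst (λ c → Side c _ _) e₁≡f₁ (after j+1≡)) ,
      (λ j+1< → subst (λ c → Side c _ _) e₁≡f₁ (before j+1<))
      where
      d₁ d₀ e₁ e₀ : Direction
      d₁ = direction (suc i)
      d₀ = direction (inject₁ i)
      e₁ = proj₁ (proj₂ (proj₂ (p-placed (suc i))))
      e₀ = proj₁ (proj₂ (proj₂ (p-placed (inject₁ i))))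
      prev prev′ : Fin (3 ℕ.+ k)
      prev  = suc (suc (inject₁ i))
      prev′ = suc (inject₁ (inject₁ i))
      own  = proj₁ (proj₂ (p-placed (suc i)))
      own′ = proj₁ (proj₂ (p-placed (inject₁ i)))
      after  = proj₁ (proj₂ (proj₂ (proj₂ (p-placed (suc i)))))
      after′ = proj₁ (proj₂ (proj₂ (proj₂ (p-placed (inject₁ i)))))
      before  = proj₂ (proj₂ (proj₂ (proj₂ (p-placed (suc i)))))
      before′ = proj₂ (proj₂ (proj₂ (proj₂ (p-placed (inject₁ i)))))
      prev≤ : toℕ (inject₁ i) ℕ.≤ toℕ i
      prev≤ = ℕₚ.≤-reflexive (Finₚ.toℕ-inject₁ i)
      prev+1≡ : suc (toℕ prev) ≡ 3 ℕ.+ toℕ i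
      prev+1≡ = cong (3 ℕ.+_) (Finₚ.toℕ-inject₁ i)
      prev′+1≡ : suc (toℕ prev′) ≡ toℕ prev
      prev′+1≡ = cong (2 ℕ.+_) (Finₚ.toℕ-inject₁ (inject₁ i))
      e₁:first : Side e₁ (p zero) (r i)
      e₁:first = before (s≤s (s≤s z≤n))
      e₁:prev : Side e₁ (p zero) (p prev)
      e₁:prev = side-trans e₁ e₁:first (after prev+1≡)
      d₀∦e₀ : axis d₀ ≢ axis e₀
      d₀∦e₀ = separation-turns d₀ e₀ (own′ (ℕₚ.≤-reflexive prev′+1≡)) (after′ prev′+1≡)
        (own′ (s≤s z≤n)) (before′ (s≤s (s≤s z≤n)))
      -- If parallel, `e₁` and `e₀` coincide. Then `r i`, `prev`, `prev′` come in this order along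
      -- `e₁`, although `prev′` must come before `r i`.
      e₁∦e₀ : axis e₁ ≢ axis e₀
      e₁∦e₀ e₁∥e₀ with e₁≡e₀ ← side-unique e₁ e₀ e₁∥e₀ e₁:prev (before′ (s≤s (s≤s z≤n))) =
        side-asym e₁
          (side-trans e₁ (after prev+1≡) (subst (λ c → Side c _ _) (sym e₁≡e₀) (after′ prev′+1≡)))
          (before (subst (ℕ._< 3 ℕ.+ toℕ i) (sym prev′+1≡) (ℕₚ.≤-reflexive prev+1≡)))
      e₁≡f₁ : e₁ ≡ f (toℕ i)
      e₁≡f₁ = trans (side-unique e₁ d₀ (third-axis e₁∦e₀ d₀∦e₀) e₁:prev (own′ (s≤s z≤n)))
        (trans (sym (letter-tabulate direction (inject₁ i))) (cong f (Finₚ.toℕ-inject₁ i)))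

    f₂-side : ∀ i {j} → j Fin.< suc (suc (suc i)) → Side (f (suc (toℕ i))) (p j) (r i)
    f₂-side i j<i = subst (λ d → Side d _ _) (sym (letter-tabulate direction (suc i)))
      (proj₁ (proj₂ (p-placed (suc i))) j<i)

  direction-word : ∃ λ w →
    length w ≡ suc k × Follows (letter w) (p zero) (λ i → p (suc (suc (suc i))))
  direction-word = tabulate direction , length-tabulate direction , record
    { bends    = λ {i} i<k → subst (λ n → axis (f n) ≢ axis (f (suc n))) (Finₚ.toℕ-fromℕ< i<k)
        (proj₁ (step (fromℕ< i<k)))
    ; origin₁  = λ i → proj₂ (proj₂ (step i)) (s≤s (s≤s z≤n))
    ; origin₂  = λ i → f₂-side i (s≤s z≤n)
    ; outwards = λ {j} {i} j<i → f₂-side i (s≤s (s≤s (s≤s j<i)))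
    ; across   = λ {j} {i} j<i → proj₂ (proj₂ (step i)) (s≤s (s≤s (s≤s j<i)))
    ; cuts     = λ {j} {i} j≡i → proj₁ (proj₂ (step i)) (cong (3 ℕ.+_) j≡i)
    }

-- Needed because taking a sequence apart into head and tail and consing them again returns it only
-- up to pointwise equality.
placed-≗ : ∀ u {p q : Fin k → Pin} → p ≗ q → ∀ i → Placed u p i → Placed u q i
placed-≗ (num m) p≗q i pl {j} j<i rewrite sym (p≗q i) | sym (p≗q j) = pl j<i
placed-≗ (dir d) {p} {q} p≗q i (own , e , after , before) =
  move d ∘ own , e , move′ ∘ after , move e ∘ before
  where
  move : ∀ d {j} → Side d (p j) (p i) → Side d (q j) (q i)
  move d = subst₂ (Side d) (p≗q _) (p≗q i)
  move′ : ∀ {j} → Side e (p i) (p j) → Side e (q i) (q j)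
  move′ = subst₂ (Side e) (p≗q i) (p≗q _)

shift-2 : ∀ a i → a ℕ.+ (2 ℕ.+ i) ≡ 2 ℕ.+ a ℕ.+ i
shift-2 a i = trans (ℕₚ.+-suc a (suc i)) (cong suc (ℕₚ.+-suc a i))

sameOrder-≗ : {p p′ q q′ : Fin k → Pin} → p ≗ p′ → q ≗ q′ → SameOrder p q → SameOrder p′ q′
sameOrder-≗ p≗ q≗ s i j rewrite sym (p≗ i) | sym (p≗ j) | sym (q≗ i) | sym (q≗ j) = s i j

module _ {p : Fin (3 ℕ.+ k) → Pin} {w : Word}
         (F : Follows (letter w) (p zero) (λ i → p (suc (suc (suc i))))) where
  private
    r : Fin k → Pin
    r i = p (suc (suc (suc i)))

  -- The pins of `u` follow `v` by their encoding, and the run of `r` starting at `a` follows the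
  -- same letters with `p zero` as origin, so `follows-unique` applies.
  factor-order : length w ≡ suc k → φ u v → ∀ a → a ℕ.+ length v ℕ.≤ length w →
    (∀ i → i ℕ.< length v → letter v i ≡ letter w (a ℕ.+ i)) →
    {q : Fin (length u) → Pin} → (∀ i → Placed (lookup u i) (o Vector.∷ q) (suc i)) →
    ∃ λ (s : Fin (length u) → Fin k) → SameOrder (o Vector.∷ q) (p zero Vector.∷ (r ∘ s))
  factor-order {u} {v} |w|≡ φuv a a+|v|≤ v≡w placed with φ⇒corner φuv
  ... | m , w′ , d , e , refl , refl , c , alt =
    s , follows-unique (placed⇒follows c alt placed)
      (follows-segment a (λ i≤l → v≡w _ (s≤s (ℕₚ.≤-trans i≤l (ℕₚ.≤-reflexive (cong suc (length-map dir w′))))))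
        s≡ (λ {i} → F.origin₁ (s i)) (λ {i} → F.origin₂ (s i)) (F.bends ∘ a+<) F)
    where
    module F = Follows F
    -- `v` has one letter more than `u`, and `w` one letter more than `r` has pins.
    a+< : ∀ {i} → i ℕ.< length u → a ℕ.+ i ℕ.< k
    a+< {i} i<l = ℕ.s≤s⁻¹ (begin-strict
      suc (a ℕ.+ i)     ≡⟨ ℕₚ.+-suc a i ⟨
      a ℕ.+ suc i       <⟨ ℕₚ.+-monoʳ-< a (s≤s i<l) ⟩
      a ℕ.+ suc (suc (length (map dir w′))) ≡⟨ cong (λ n → a ℕ.+ suc (suc n)) (length-map dir w′) ⟩
      a ℕ.+ length v    ≤⟨ a+|v|≤ ⟩
      length w          ≡⟨ |w|≡ ⟩
      suc k             ∎)
      where open ℕₚ.≤-Reasoning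
    s : Fin (length u) → Fin k
    s i = fromℕ< (a+< (Finₚ.toℕ<n i))
    s≡ : ∀ i → toℕ (s i) ≡ a ℕ.+ toℕ i
    s≡ i = Finₚ.toℕ-fromℕ< _

  factor-contains : ∀ {π σ} → length w ≡ suc k → OrderIsomorphic p (diagram σ) →
    E π v → Factor v w → π ≼ σ
  factor-contains {v} {π} {σ} |w|≡ p≅σ (inj₁ (u , _ , (p₀ , q , (_ , q≅π) , _ , enc) , φuv)) fac
    with factor-letters fac
  ... | a , a+|v|≤ , v≡w
    with factor-order |w|≡ φuv a a+|v|≤ v≡w (λ i → encodes⇒placed (lookup u i) (suc i) (enc i))
  ... | s , q≅ = embedding {π = π} {σ} (λ i → suc (suc (suc (s i)))) q≅π p≅σ (λ i j → q≅ (suc i) (suc j))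
  -- Quasi-strict case: the match of `v′` starts two letters later, after the turn `t`. The first
  -- pin of the word acts as origin of the others and is sent to `p zero`, so the origin is part of
  -- the embedding.
  factor-contains {v} {π} {σ} |w|≡ p≅σ
    (inj₂ (_ , num _ ∷ u , _ , (p₀ , q , (_ , q≅π) , _ , enc) , t , v′ , t∈ , φuv′ , refl)) fac
    with turn⇒pair t∈ | factor-letters fac
  ... | d , e , refl | a , a+|v|≤ , v≡w
    with factor-order |w|≡ φuv′ (2 ℕ.+ a)
      (subst (ℕ._≤ length w) (shift-2 a (length v′)) a+|v|≤)
      (λ i i< → trans (v≡w (2 ℕ.+ i) (s≤s (s≤s i<))) (cong (letter w) (shift-2 a i)))
      {q = q ∘ suc}
      (λ i → placed-≗ (lookup u i) (λ { zero → refl ; (suc _) → refl }) (suc i)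
        (placed-tail (lookup u i) (suc i) (encodes⇒placed (lookup u i) (suc (suc i)) (enc (suc i)))))
  ... | s , q≅ = embedding {π = π} {σ} (zero Vector.∷ λ i → suc (suc (suc (s i)))) q≅π p≅σ
    (sameOrder-≗ (λ { zero → refl ; (suc _) → refl }) (λ { zero → refl ; (suc _) → refl }) q≅)

  avoids-forbidden : ∀ {ℓ} {B : Pred Perm ℓ} {σ} → length w ≡ suc k →
    OrderIsomorphic p (diagram σ) → Av B σ → HasNoFactorIn (Forbidden B) w
  avoids-forbidden {σ = σ} |w|≡ p≅σ avoids v (inj₁ (π , Bπ , Eπv)) fac =
    avoids π Bπ (factor-contains {π = π} {σ} |w|≡ p≅σ Eπv fac)
  avoids-forbidden |w|≡ _ _ v (inj₂ v∈) fac with nonTurn⇒pair v∈ | factor-letters fac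
  ... | d , e , refl , d∥e | a , a+2≤ , v≡w =
    Follows.bends F
      (ℕ.s≤s⁻¹ (subst₂ ℕ._≤_ (trans (shift-2 a 0) (cong (2 ℕ.+_) (ℕₚ.+-identityʳ a))) |w|≡ a+2≤))
      (subst₂ (λ d e → axis d ≡ axis e)
        (trans (v≡w 0 (s≤s z≤n)) (cong (letter w) (ℕₚ.+-identityʳ a)))
        (trans (v≡w 1 (s≤s (s≤s z≤n))) (cong (letter w) (ℕₚ.+-comm a 1)))
        d∥e)

unbounded-words : ∀ {ℓ} {B : Pred Perm ℓ} →
  ArbitrarilyLong ∣_∣ (Av B ∩ ProperPinPermutation) → ArbitrarilyLong length (HasNoFactorIn (Forbidden B))
-- `direction-word` takes at least three pins; `N` further ones make a word of `N + 1` letters.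
unbounded-words {B = B} perms N = from-permutation (perms (3 ℕ.+ N))
  where
  from-word : ∀ {k} {σ : Perm} {p : Fin (3 ℕ.+ k) → Pin} → N ℕ.≤ k →
    Av B σ → OrderIsomorphic p (diagram σ) →
    (∃ λ w → length w ≡ suc k × Follows (letter w) (p zero) (λ i → p (suc (suc (suc i))))) →
    ∃ λ w → N ℕ.≤ length w × HasNoFactorIn (Forbidden B) w
  from-word {σ = σ} N≤k avoids p≅σ (w , |w|≡ , F) =
    w , ℕₚ.≤-trans (ℕₚ.m≤n⇒m≤1+n N≤k) (ℕₚ.≤-reflexive (sym |w|≡)) ,
    avoids-forbidden F {σ = σ} |w|≡ p≅σ avoids

  from-permutation : (∃ λ σ → 3 ℕ.+ N ℕ.≤ ∣ σ ∣ × Av B σ × ProperPinPermutation σ) →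
    ∃ λ w → N ℕ.≤ length w × HasNoFactorIn (Forbidden B) w
  from-permutation (σ@(suc (suc _) , _) , s≤s (s≤s (s≤s N≤k)) , avoids , _ , (p-pins , p≅σ) , p-proper) =
    from-word {σ = σ} N≤k avoids p≅σ (direction-word p-pins p-proper)

-- Ranks and the permutation drawn by a set of pins.

module _ (c : Fin n → ℤ) where
  private
    below : Fin n → Subset n
    below i = Vec.tabulate λ j → does (c j ℤₚ.<? c i)

    ∈-below : ∀ {i j} → c j ℤ.< c i → j ∈ below i
    ∈-below {i} {j} lt = Vecₚ.lookup⇒[]= j (below i)
      (trans (Vecₚ.lookup∘tabulate _ j) (dec-true (c j ℤₚ.<? c i) lt))

    below-∈ : ∀ {i j} → j ∈ below i → c j ℤ.< c i
    below-∈ {i} {j} j∈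
      with c j ℤₚ.<? c i
         | trans (sym (Vecₚ.lookup∘tabulate (λ j → does (c j ℤₚ.<? c i)) j))
                 (Vecₚ.[]=⇒lookup j∈)
    ... | yes lt | _ = lt

    card-below< : ∀ i → card (below i) ℕ.< n
    card-below< i = subst (card (below i) ℕ.<_) (Subsetₚ.∣⊤∣≡n n)
      (Subsetₚ.p⊂q⇒∣p∣<∣q∣ ((λ _ → Subsetₚ.∈⊤) , i , Subsetₚ.∈⊤ , ℤₚ.<-irrefl refl ∘ below-∈))

    rank : Fin n → Fin n
    rank i = fromℕ< (card-below< i)

    rank-mono : ∀ {i j} → c i ℤ.< c j → rank i Fin.< rank j
    rank-mono {i} {j} lt =
      subst₂ ℕ._<_ (sym (Finₚ.toℕ-fromℕ< _)) (sym (Finₚ.toℕ-fromℕ< _))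
        (Subsetₚ.p⊂q⇒∣p∣<∣q∣
          ((λ k∈ → ∈-below (ℤₚ.<-trans (below-∈ k∈) lt)) , i , ∈-below lt , ℤₚ.<-irrefl refl ∘ below-∈))

  -- The rank of an index counts the smaller values. Strict inclusion of these sets makes ranks
  -- strictly monotone, hence injective. They are onto because a missed rank could be punched out,
  -- leaving an injection into a smaller set.
  ranking : Injective _≡_ _≡_ c →
    ∃ λ (τ : Permutation′ n) → ∀ i j → c i ℤ.< c j ⇔ (τ ⟨$⟩ʳ i) Fin.< (τ ⟨$⟩ʳ j)
  ranking c-inj = permutation rank (proj₁ ∘ rank-onto) (proj₂ ∘ rank-onto)
      (λ i → rank-inj (proj₂ (rank-onto (rank i)))) ,
    λ i j → mk⇔ rank-mono (rank-cancel i j)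
    where
    rank-cancel : ∀ i j → rank i Fin.< rank j → c i ℤ.< c j
    rank-cancel i j lt with ℤₚ.<-cmp (c i) (c j)
    ... | tri< a _ _ = a
    ... | tri≈ _ b _ = contradiction (cong (toℕ ∘ rank) (c-inj b)) (ℕₚ.<⇒≢ lt)
    ... | tri> _ _ a = contradiction (rank-mono a) (ℕₚ.<-asym lt)
    rank-inj : Injective _≡_ _≡_ rank
    rank-inj {i} {j} eq with ℤₚ.<-cmp (c i) (c j)
    ... | tri< a _ _ = contradiction (cong toℕ eq) (ℕₚ.<⇒≢ (rank-mono a))
    ... | tri≈ _ b _ = c-inj b
    ... | tri> _ _ a = contradiction (cong toℕ (sym eq)) (ℕₚ.<⇒≢ (rank-mono a))
    rank-onto : ∀ j → ∃ λ i → rank i ≡ j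
    rank-onto j = injective⇒onto rank-inj j
      where
      injective⇒onto : ∀ {n} {f : Fin n → Fin n} → Injective _≡_ _≡_ f → ∀ j → ∃ λ i → f i ≡ j
      injective⇒onto {suc n} {f} f-inj j = decidable-stable (Finₚ.any? λ i → f i Finₚ.≟ j) λ ∄i →
        let misses = λ i (j≡fi : j ≡ f i) → ∄i (i , sym j≡fi) in
        ℕₚ.1+n≰n (Finₚ.injective⇒≤ {f = Fin.punchOut ∘ misses}
          λ {i} {i′} → f-inj ∘ Finₚ.punchOut-injective (misses i) (misses i′))

permutation-of-pins : (r : Fin (suc k) → Pin) → Distinct r →
  ∃ λ (σ : Permutation′ (suc k)) → OrderIsomorphic r (diagram (k , σ))
permutation-of-pins {k} r r-distinct = from-rankings (ranking (x ∘ r) (injective proj₁)) (ranking (y ∘ r) (injective proj₂))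
  where
  open Equivalence

  injective : ∀ {c : Pin → ℤ} → (∀ {p q} → Apart p q → c p ≢ c q) → Injective _≡_ _≡_ (c ∘ r)
  injective apart≢ {i} {j} ci≡cj = decidable-stable (i Finₚ.≟ j) λ i≢j → apart≢ (r-distinct i j i≢j) ci≡cj

  Ranking : (Fin (suc k) → ℤ) → Set
  Ranking c = ∃ λ (τ : Permutation′ (suc k)) → ∀ i j → c i ℤ.< c j ⇔ (τ ⟨$⟩ʳ i) Fin.< (τ ⟨$⟩ʳ j)

  from-rankings : Ranking (x ∘ r) → Ranking (y ∘ r) →
    ∃ λ (σ : Permutation′ (suc k)) → OrderIsomorphic r (diagram (k , σ))
  -- The permutation sends the x-rank of a pin to its y-rank.
  from-rankings (τ , x-order) (ρ , y-order) = flip τ ∘ₚ ρ , τ , λ i j →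
    mk⇔ (ℤ.+<+ ∘ to (x-order i j)) (from (x-order i j) ∘ ℤₚ.drop‿+<+) ,
    subst₂ (λ i′ j′ → y (r i) ℤ.< y (r j) ⇔ + toℕ (ρ ⟨$⟩ʳ i′) ℤ.< + toℕ (ρ ⟨$⟩ʳ j′))
      (sym (inverseˡ τ)) (sym (inverseˡ τ))
      (mk⇔ (ℤ.+<+ ∘ to (y-order i j)) (from (y-order i j) ∘ ℤₚ.drop‿+<+))

-- Maximal runs, intervals and simplicity.

module _ {Q : Pred ℕ 0ℓ} (Q? : Decidable Q) where

  maximum : ∀ K → (∀ {m} → Q m → m ℕ.< K) → ∃ Q → ∃ λ b → Q b × (∀ {m} → Q m → m ℕ.≤ b)
  maximum zero    Q< (_ , Qm) = contradiction (Q< Qm) λ ()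
  maximum (suc K) Q< Q≢∅ with Q? K
  ... | yes QK = K , QK , ℕ.s≤s⁻¹ ∘ Q<
  ... | no ¬QK = maximum K (λ Qm → ℕₚ.≤∧≢⇒< (ℕ.s≤s⁻¹ (Q< Qm)) λ { refl → ¬QK Qm }) Q≢∅

  -- Serves twice: for the interval spanned by a convex set and for the last run of pins used by a
  -- pattern.
  run-start : ∀ b → Q b → ∃ λ a → a ℕ.≤ b × (∀ {m} → a ℕ.≤ m → m ℕ.≤ b → Q m) ×
    (∀ {m} → suc m ≡ a → ¬ Q m)
  run-start zero Qb = zero , z≤n , (λ { _ z≤n → Qb }) , λ ()
  run-start (suc b) Qb with Q? b
  ... | no ¬Qb = suc b , ℕₚ.≤-refl , (λ a≤m m≤b → subst Q (ℕₚ.≤-antisym a≤m m≤b) Qb) ,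
    λ { refl → ¬Qb }
  ... | yes Qb′ with run-start b Qb′
  ... | a , a≤b , run , ¬Q = a , ℕₚ.m≤n⇒m≤1+n a≤b , run′ , ¬Q
    where
    run′ : ∀ {m} → a ℕ.≤ m → m ℕ.≤ suc b → Q m
    run′ {m} a≤m m≤b+1 with ℕₚ.m≤n⇒m<n∨m≡n m≤b+1
    ... | inj₁ m≤b  = run a≤m (ℕ.s≤s⁻¹ m≤b)
    ... | inj₂ refl = Qb

Convex : Pred (Fin n) 0ℓ → Set
Convex Q = ∀ {i j k} → i Fin.< j → j Fin.< k → Q i → Q k → Q j

-- The run of `Q` that ends at its maximum is all of `Q`: an element before the start of the run
-- would by convexity put the predecessor of the start into `Q`.
convex-interval : {Q : Pred (Fin n) 0ℓ} → Decidable Q → Convex Q → ∃ Q →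
  ∃₂ λ a b → a ℕ.≤ b × b ℕ.< n × Q ≐ [ a , suc b ⟩
convex-interval {n} {Q} Q? Q-convex (i , Qi) with maximum Q∘? n Q< (_ , i , Qi , refl)
  where
  Q∘ : Pred ℕ 0ℓ
  Q∘ m = ∃ λ i → Q i × toℕ i ≡ m
  Q∘? : Decidable Q∘
  Q∘? m = Finₚ.any? λ i → Q? i ×-dec toℕ i ℕₚ.≟ m
  Q< : ∀ {m} → Q∘ m → m ℕ.< n
  Q< (i , _ , refl) = Finₚ.toℕ<n i
... | b , Qb@(i′ , _ , i′≡b) , ≤b with run-start (λ m → Finₚ.any? λ i → Q? i ×-dec toℕ i ℕₚ.≟ m) b Qb
... | a , a≤b , run , ¬Q =
  a , b , a≤b , subst (ℕ._< n) i′≡b (Finₚ.toℕ<n i′) ,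
  (λ {j} Qj → ≥a j Qj , s≤s (≤b (j , Qj , refl))) ,
  λ {j} (a≤j , j<b+1) → from-ℕ j (run a≤j (ℕ.s≤s⁻¹ j<b+1))
  where
  from-ℕ : ∀ j → (∃ λ i → Q i × toℕ i ≡ toℕ j) → Q j
  from-ℕ j (i , Qi , eq) with refl ← Finₚ.toℕ-injective {i = i} {j} eq = Qi
  ≥a : ∀ j → Q j → a ℕ.≤ toℕ j
  ≥a j Qj with a ℕₚ.≤? toℕ j
  ... | yes a≤j = a≤j
  ... | no a≰j with run ℕₚ.≤-refl a≤b
  ... | i , Qi , refl with toℕ i in eq
  ... | zero = contradiction z≤n a≰j
  ... | suc a′ = contradiction Qa′ (¬Q refl)
    where
    a′<n : a′ ℕ.< n
    a′<n = ℕₚ.≤-trans (ℕₚ.≤-reflexive (sym eq)) (ℕₚ.<⇒≤ (Finₚ.toℕ<n i))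
    Qa′ : ∃ λ i → Q i × toℕ i ≡ a′
    Qa′ with toℕ j ℕₚ.≟ a′
    ... | yes j≡a′ = j , Qj , j≡a′
    ... | no j≢a′ = fromℕ< a′<n ,
      Q-convex {j} {_} {i}
        (subst (toℕ j ℕ.<_) (sym (Finₚ.toℕ-fromℕ< a′<n)) (ℕₚ.≤∧≢⇒< (ℕ.s≤s⁻¹ (ℕₚ.≰⇒> a≰j)) j≢a′))
        (subst₂ ℕ._<_ (sym (Finₚ.toℕ-fromℕ< a′<n)) (sym eq) ℕₚ.≤-refl)
        Qj Qi , Finₚ.toℕ-fromℕ< a′<n

-- An interval of a permutation is a set of points that no other point cuts.
simple⇒no-block : ∀ {π} {T : Pred (Fin ∣ π ∣) 0ℓ} → Simple π → Decidable T →
  (∀ {z i j} → ¬ T z → T i → T j →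
    (z Fin.< i → z Fin.< j) × ((π at z) Fin.< (π at i) → (π at z) Fin.< (π at j))) →
  ∀ {i j z} → i Fin.< j → T i → T j → T z
simple⇒no-block {π@(n , ρ)} {T} simple T? uncut {i} {j} {z} i<j Ti Tj =
  decidable-stable (T? z) ¬¬Tz
  where
  V : Pred (Fin ∣ π ∣) 0ℓ
  V = Image π T

  V? : Decidable V
  V? v = Finₚ.any? λ i → T? i ×-dec (π at i) Finₚ.≟ v

  -- A point outside `T` that is between two points of `T`, by position or by value, would lie on
  -- different sides of them, against `uncut`.
  T-convex : Convex T
  T-convex {j = j} i<j j<k Ti Tk = decidable-stable (T? j) λ ¬Tj →
    ℕₚ.<-asym i<j (proj₁ (uncut ¬Tj Tk Ti) j<k)

  V-convex : Convex V
  V-convex {j = j} i<j j<k (i , Ti , refl) (k , Tk , refl) =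
    ρ ⟨$⟩ˡ j , decidable-stable (T? _) (λ ¬T → ℕₚ.<-asym i<j (subst (Fin._< (π at i)) (inverseʳ ρ)
      (proj₂ (uncut ¬T Tk Ti) (subst (Fin._< (π at k)) (sym (inverseʳ ρ)) j<k)))) , inverseʳ ρ

  ¬¬Tz : ¬ ¬ T z
  ¬¬Tz ¬Tz = from-intervals (convex-interval T? T-convex (i , Ti))
                            (convex-interval V? V-convex (_ , i , Ti , refl))
    where
    Interval : Pred (Fin ∣ π ∣) 0ℓ → Set
    Interval P = ∃₂ λ a b → a ℕ.≤ b × b ℕ.< ∣ π ∣ × P ≐ [ a , suc b ⟩

    from-intervals : Interval T → ¬ Interval V
    from-intervals (a , b , a≤b , b<n , T⊆ , T⊇) (c , d , _ , _ , V⊆ , V⊇) =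
      simple a len 2≤len len<n (subst (ℕ._≤ suc n) (sym a+len≡) b<n)
        (c , suc d , (λ { (i , i∈ , refl) → V⊆ (i , T⊇ (subst (λ e → [ a , e ⟩ i) a+len≡ i∈) , refl) }) ,
         λ v∈ → let i , Ti , eq = V⊇ v∈ in i , subst (λ e → [ a , e ⟩ i) (sym a+len≡) (T⊆ Ti) , eq)
      where
      len : ℕ
      len = suc b ℕ.∸ a
      a+len≡ : a ℕ.+ len ≡ suc b
      a+len≡ = ℕₚ.m+[n∸m]≡n (ℕₚ.m≤n⇒m≤1+n a≤b)
      2≤len : 2 ℕ.≤ len
      2≤len = ℕₚ.+-cancelˡ-≤ a 2 len (begin
        a ℕ.+ 2         ≡⟨ ℕₚ.+-comm a 2 ⟩
        suc (suc a)     ≤⟨ s≤s (s≤s (proj₁ (T⊆ Ti))) ⟩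
        suc (suc (toℕ i)) ≤⟨ s≤s i<j ⟩
        suc (toℕ j)     ≤⟨ proj₂ (T⊆ Tj) ⟩
        suc b           ≡⟨ a+len≡ ⟨
        a ℕ.+ len         ∎)
        where open ℕₚ.≤-Reasoning
      -- The interval is proper because the position `z` is outside it, either beyond its end or
      -- before its start.
      len<n : len ℕ.< suc n
      len<n with a ℕₚ.≤? toℕ z | toℕ z ℕₚ.<? suc b
      ... | yes a≤z | yes z<b+1 = contradiction (T⊇ (a≤z , z<b+1)) ¬Tz
      ... | yes _   | no z≮b+1 =
        ℕₚ.≤-<-trans (ℕₚ.m∸n≤m (suc b) a) (ℕₚ.≤-<-trans (ℕₚ.≮⇒≥ z≮b+1) (Finₚ.toℕ<n z))
      ... | no a≰z  | _ = ℕₚ.<-≤-trans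
        (ℕₚ.∸-monoʳ-< (ℕₚ.≤-<-trans z≤n (ℕₚ.≰⇒> a≰z)) (ℕₚ.m≤n⇒m≤1+n a≤b)) b<n

-- A spiral realising any alternating word.

sign : Direction → ℤ → ℤ
sign U i = i
sign D i = - i
sign L i = - i
sign R i = i

sign-involutive : ∀ d i → sign d (sign d i) ≡ i
sign-involutive U i = refl
sign-involutive D i = ℤₚ.neg-involutive i
sign-involutive L i = ℤₚ.neg-involutive i
sign-involutive R i = refl

∣sign∣ : ∀ d i → ℤ.∣ sign d i ∣ ≡ ℤ.∣ i ∣
∣sign∣ U i = refl
∣sign∣ D i = ℤₚ.∣-i∣≡∣i∣ i
∣sign∣ L i = ℤₚ.∣-i∣≡∣i∣ i
∣sign∣ R i = refl

-- The coordinate signed so as to grow in direction `d`, which turns the four cases of `Side` into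
-- one inequality.
along : Direction → Pin → ℤ
along d p = sign d (coordinate (axis d) p)

along⇒side : ∀ d → along d p ℤ.< along d q → Side d p q
along⇒side U lt = lt
along⇒side D lt = ℤₚ.neg-cancel-< lt
along⇒side L lt = ℤₚ.neg-cancel-< lt
along⇒side R lt = lt

pinWith : Axis → ℤ → ℤ → Pin
pinWith horizontal i j = i , j
pinWith vertical   i j = j , i

coordinate-pinWith : ∀ a i j → coordinate a (pinWith a i j) ≡ i
coordinate-pinWith horizontal i j = refl
coordinate-pinWith vertical   i j = refl

coordinate-pinWith-≢ : ∀ {a b} i j → a ≢ b → coordinate b (pinWith a i j) ≡ j
coordinate-pinWith-≢ {horizontal} {horizontal} i j a≢b = contradiction refl a≢b
coordinate-pinWith-≢ {horizontal} {vertical}   i j _   = refl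
coordinate-pinWith-≢ {vertical}   {horizontal} i j _   = refl
coordinate-pinWith-≢ {vertical}   {vertical}   i j a≢b = contradiction refl a≢b

-- Pin i must lie further out than pin i-1 along the axis of f(i+1), and along
-- the axis of f(i) strictly between pin i-1 and all pins before it: the
-- distances near and far satisfy far(i-2) < near(i) < far(i-1) < far(i).
near far : ℕ → ℕ
near i = suc (2 ℕ.* i)
far  i = 2 ℕ.* (2 ℕ.+ i)

spiral : (ℕ → Direction) → ℕ → Pin
spiral f i = pinWith (axis (f i)) (sign (f i) (+ near i)) (sign (f (suc i)) (+ far i))

far-mono : ∀ {i j} → j ℕ.< i → far j ℕ.< far i
far-mono j<i = ℕₚ.*-monoʳ-< 2 (s≤s (s≤s j<i))

far<near : ∀ {i j} → suc j ℕ.< i → far j ℕ.< near i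
far<near j+1<i = s≤s (ℕₚ.*-monoʳ-≤ 2 j+1<i)

near<far : ∀ j → near (suc j) ℕ.< far j
near<far j = ℕₚ.≤-reflexive (sym (ℕₚ.*-suc 2 (suc j)))

near≤far : ∀ i → near i ℕ.≤ far i
near≤far i = ℕₚ.≤-trans (ℕₚ.<⇒≤ (ℕₚ.n<1+n (near i)))
  (ℕₚ.≤-trans (ℕₚ.≤-reflexive (sym (ℕₚ.*-suc 2 i))) (ℕₚ.*-monoʳ-≤ 2 (ℕₚ.n≤1+n (suc i))))

origin : Pin
origin = + 0 , + 0

along-origin : ∀ d → along d origin ≡ + 0
along-origin U = refl
along-origin D = refl
along-origin L = refl
along-origin R = refl

module _ (f : ℕ → Direction) where

  private
    P : ℕ → Pin
    P = spiral f

  along-near : ∀ i → along (f i) (P i) ≡ + near i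
  along-near i = trans (cong (sign (f i)) (coordinate-pinWith (axis (f i)) _ _)) (sign-involutive (f i) _)

  along-far : ∀ i → axis (f i) ≢ axis (f (suc i)) → along (f (suc i)) (P i) ≡ + far i
  along-far i bend = trans (cong (sign (f (suc i))) (coordinate-pinWith-≢ _ _ bend)) (sign-involutive (f (suc i)) _)

  -- Holds for every `d`, related to the letters of pin `i` or not: both coordinates have absolute
  -- value at most `far i`. A later pin is therefore beyond it as soon as its own `near` or `far` is
  -- larger.
  along≤far : ∀ d i → along d (P i) ℤ.≤ + far i
  along≤far d i = ℤₚ.≤-trans (i≤+∣i∣ _) (ℤ.+≤+ (ℕₚ.≤-trans (ℕₚ.≤-reflexive (∣sign∣ d _)) ∣coordinate∣≤))
    where
    i≤+∣i∣ : ∀ i → i ℤ.≤ + ℤ.∣ i ∣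
    i≤+∣i∣ (+ n) = ℤₚ.≤-refl
    i≤+∣i∣ ℤ.-[1+ n ] = ℤ.-≤+
    ∣coordinate∣≤ : ℤ.∣ coordinate (axis d) (P i) ∣ ℕ.≤ far i
    ∣coordinate∣≤ with axis (f i) ≟ₐ axis d
    ... | yes eq = ℕₚ.≤-trans (ℕₚ.≤-reflexive (trans
      (cong ℤ.∣_∣ (trans (cong (λ a → coordinate a (P i)) (sym eq)) (coordinate-pinWith (axis (f i)) _ _)))
      (∣sign∣ (f i) _))) (near≤far i)
    ... | no ≢ = ℕₚ.≤-reflexive (trans (cong ℤ.∣_∣ (coordinate-pinWith-≢ _ _ ≢)) (∣sign∣ (f (suc i)) _))

  spiral-follows : (∀ {i} → i ℕ.< k → axis (f i) ≢ axis (f (suc i))) →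
    Follows {k} f origin (P ∘ toℕ)
  spiral-follows {k} bends = record
    { bends    = bends
    ; origin₁  = λ i → along⇒side _ (subst₂ ℤ._<_
        (sym (along-origin (f (toℕ i)))) (sym (along-near (toℕ i))) (ℤ.+<+ (s≤s z≤n)))
    ; origin₂  = λ i → along⇒side _ (subst₂ ℤ._<_
        (sym (along-origin (f (suc (toℕ i))))) (sym (along-far′ i)) (ℤ.+<+ (s≤s z≤n)))
    ; outwards = λ {j} {i} j<i → along⇒side _ (ℤₚ.≤-<-trans (along≤far (f (suc (toℕ i))) (toℕ j))
        (subst (+ far (toℕ j) ℤ.<_) (sym (along-far′ i)) (ℤ.+<+ (far-mono j<i))))
    ; across   = λ {j} {i} j+1<i → along⇒side _ (ℤₚ.≤-<-trans (along≤far (f (toℕ i)) (toℕ j))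
        (subst (+ far (toℕ j) ℤ.<_) (sym (along-near (toℕ i))) (ℤ.+<+ (far<near j+1<i))))
    ; cuts     = λ {j} {i} j+1≡i → along⇒side _ (subst₂ ℤ._<_ (sym (along-near (toℕ i)))
        (trans (sym (along-far′ j)) (cong (λ n → along (f n) (P (toℕ j))) j+1≡i))
        (ℤ.+<+ (subst (λ n → near n ℕ.< far (toℕ j)) j+1≡i (near<far (toℕ j)))))
    }
    where
    along-far′ : ∀ (i : Fin k) → along (f (suc (toℕ i))) (P (toℕ i)) ≡ + far (toℕ i)
    along-far′ i = along-far (toℕ i) (bends (Finₚ.toℕ<n i))

-- Pin sequences and pin words obtained from placed pins.

follows⇒pinSequence : {f : ℕ → Direction} {r : Fin k → Pin} → Follows f o r → IsPinSequence r × IsProper r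
follows⇒pinSequence {f = f} {r} F =
  (follows-distinct F , λ i _ → placed⇒pin (dir (f (suc (toℕ i)))) i (placed i)) ,
  λ i _ → placed⇒separates i (placed i)
  where
  open Follows F
  placed : ∀ i → Placed (dir (f (suc (toℕ i)))) r i
  placed i = outwards , f (toℕ i) , cuts , across

tail-distinct : {r : Fin k → Pin} → Distinct (o Vector.∷ r) → Distinct r
tail-distinct d i j i≢j = d (suc i) (suc j) (i≢j ∘ Finₚ.suc-injective)

-- The word starts with a numeral because `Encodes` admits a direction only from the second pin on.
correspondsTo : ∀ {π} {q : Fin (suc (length u)) → Pin} →
  OrderIsomorphic q (diagram π) → Distinct (o Vector.∷ q) →
  (∀ i → Placed (lookup (num m ∷ u) i) (o Vector.∷ q) (suc i)) → CorrespondsTo (num m ∷ u) π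
correspondsTo {u} {o} {m} {q = q} q≅π apart placed =
  o , q ,
  ((tail-distinct apart , λ i _ → placed⇒pin (letterAt i) i (placed-tail (letterAt i) i (placed i))) , q≅π) ,
  (apart , λ { (suc i) _ → placed⇒pin (letterAt i) (suc i) (placed i) }) ,
  λ { zero → placed⇒encodes-num {m = m} (suc zero) (placed zero)
    ; (suc i) → placed⇒encodes (lookup u i) (suc (suc i)) (s≤s (s≤s z≤n)) (placed (suc i)) }
  where
  letterAt : Fin (suc (length u)) → Letter
  letterAt = lookup (num m ∷ u)

-- `s` and `h` enumerate the same pins of `r`, the first in the order of the pin sequence and the
-- second by position in `π`. Matching the two enumerations is the required bijection.
orderIsomorphic-range : ∀ {K π} {q : Fin k → Pin} {r : Fin K → Pin}
  (s : Fin k → Fin K) (h : Fin ∣ π ∣ → Fin K) → Injective _≡_ _≡_ s → Injective _≡_ _≡_ h →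
  (∀ i → ∃ λ z → h z ≡ s i) → (∀ z → ∃ λ i → s i ≡ h z) →
  q ≗ r ∘ s → SameOrder (diagram π) (r ∘ h) → OrderIsomorphic q (diagram π)
orderIsomorphic-range {π = π} {q} {r} s h s-inj h-inj s⊆h h⊆s q≗rs π≅rh =
  permutation (proj₁ ∘ s⊆h) (proj₁ ∘ h⊆s)
    (λ z → h-inj (trans (proj₂ (s⊆h _)) (proj₂ (h⊆s z))))
    (λ i → s-inj (trans (proj₂ (h⊆s _)) (proj₂ (s⊆h i)))) ,
  λ i j → agree-sym (subst₂ (Agree (diagram π _) (diagram π _)) (rh≡q i) (rh≡q j) (π≅rh _ _))
  where
  rh≡q : ∀ i → r (h (proj₁ (s⊆h i))) ≡ q i
  rh≡q i = trans (cong r (proj₂ (s⊆h i))) (sym (q≗rs i))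

sameOrder-injective : ∀ {K π} {r : Fin K → Pin} (h : Fin ∣ π ∣ → Fin K) →
  SameOrder (diagram π) (r ∘ h) → Injective _≡_ _≡_ h
sameOrder-injective {r = r} h same {i} {j} hi≡hj with Finₚ.<-cmp i j
... | tri≈ _ i≡j _ = i≡j
... | tri< i<j _ _ = contradiction (Equivalence.to (proj₁ (same i j)) (ℤ.+<+ i<j))
  (ℤₚ.<-irrefl (cong (x ∘ r) hi≡hj))
... | tri> _ _ j<i = contradiction (Equivalence.to (proj₁ (same j i)) (ℤ.+<+ j<i))
  (ℤₚ.<-irrefl (cong (x ∘ r) (sym hi≡hj)))

-- From an occurrence of a simple pattern to a factor in `E`.

letters-prefix : ∀ v w → length v ℕ.≤ length w →
  (∀ i → i ℕ.< length v → letter v i ≡ letter w i) → Prefix _≡_ v w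
letters-prefix []      w       _        _   = []
letters-prefix (_ ∷ v) (_ ∷ w) (s≤s n≤) v≡w =
  v≡w 0 (s≤s z≤n) ∷ letters-prefix v w n≤ λ i i< → v≡w (suc i) (s≤s i<)

letters-factor : ∀ v w a → a ℕ.+ length v ℕ.≤ length w →
  (∀ i → i ℕ.< length v → letter v i ≡ letter w (a ℕ.+ i)) → Factor v w
letters-factor v w       zero    n≤       v≡w = here (letters-prefix v w n≤ v≡w)
letters-factor v (_ ∷ w) (suc a) (s≤s n≤) v≡w = there (letters-factor v w a n≤ v≡w)

letter-applyUpTo : ∀ (g : ℕ → Direction) n i → i ℕ.< n → letter (applyUpTo g n) i ≡ g i
letter-applyUpTo g (suc n) zero    _         = refl
letter-applyUpTo g (suc n) (suc i) (s≤s i<n) = letter-applyUpTo (g ∘ suc) n i i<n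

strict-applyUpTo : ∀ (g : ℕ → Direction) {n} → n ≢ 0 → Strict (num m ∷ map dir (applyUpTo g n))
strict-applyUpTo g {zero}  n≢0 = contradiction refl n≢0
strict-applyUpTo g {suc n} _   = strict _ _ _

module _ {w : Word} (|w|≡ : length w ≡ suc (suc k)) {r : Fin (suc k) → Pin}
         (F : Follows (letter w) o r) where
  private
    module F = Follows F

    f : ℕ → Direction
    f = letter w

  -- The pins `a` to `a + l`. These are `l + 1` pins, so they read `l + 2` letters, the first two of
  -- which become the numeral of `segmentWord`.
  module Segment (a l : ℕ) (a+l≤k : a ℕ.+ l ℕ.≤ k) where

    letters : ℕ → Direction
    -- With `a` as the second summand, `letters 0` and `letters (suc i)` reduce to `f a` and
    -- `f (suc (i ℕ.+ a))`.
    letters i = f (i ℕ.+ a)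

    letters-bend : ∀ {i} → i ℕ.≤ l → axis (letters i) ≢ axis (letters (suc i))
    letters-bend {i} i≤l = F.bends (s≤s (ℕₚ.≤-trans (ℕₚ.+-monoˡ-≤ a i≤l)
      (ℕₚ.≤-trans (ℕₚ.≤-reflexive (ℕₚ.+-comm l a)) a+l≤k)))

    segment tail : Word
    segment = applyUpTo letters (2 ℕ.+ l)
    tail = drop 2 segment

    segment-alternating : Alternating segment
    segment-alternating = Linkedₚ.applyUpTo⁺₁ letters (2 ℕ.+ l) (letters-bend ∘ ℕ.s≤s⁻¹ ∘ ℕ.s≤s⁻¹)

    head-corner : ∃ λ m → Corner m (letters 0) (letters 1)
    head-corner = corner (letters-bend z≤n)

    segmentWord : PinWord
    segmentWord = num (proj₁ head-corner) ∷ map dir tail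

    φ-segment : φ segmentWord segment
    φ-segment = corner⇒φ (proj₂ head-corner) segment-alternating

    length-segmentWord : length segmentWord ≡ suc l
    length-segmentWord = cong suc (trans (length-map dir tail) (length-applyUpTo _ l))

    segment-letters : ∀ i → i ℕ.< 2 ℕ.+ l → letter segment i ≡ f (a ℕ.+ i)
    segment-letters i i< = trans (letter-applyUpTo letters (2 ℕ.+ l) i i<) (cong f (ℕₚ.+-comm i a))

    index≤ : ∀ (i : Fin (length segmentWord)) → toℕ i ℕ.≤ l
    index≤ i = ℕ.s≤s⁻¹ (subst (toℕ i ℕ.<_) length-segmentWord (Finₚ.toℕ<n i))

    index< : ∀ i → a ℕ.+ toℕ i ℕ.< suc k
    index< i = s≤s (ℕₚ.≤-trans (ℕₚ.+-monoʳ-≤ a (index≤ i)) a+l≤k)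

    index : Fin (length segmentWord) → Fin (suc k)
    index i = fromℕ< (index< i)

    toℕ-index : ∀ i → toℕ (index i) ≡ a ℕ.+ toℕ i
    toℕ-index i = Finₚ.toℕ-fromℕ< (index< i)

    index-injective : Injective _≡_ _≡_ index
    index-injective {i} {j} eq = Finₚ.toℕ-injective (ℕₚ.+-cancelˡ-≡ a _ _
      (trans (sym (toℕ-index i)) (trans (cong toℕ eq) (toℕ-index j))))

    index-onto : ∀ j → a ℕ.≤ toℕ j → toℕ j ℕ.≤ a ℕ.+ l → ∃ λ i → index i ≡ j
    index-onto j a≤j j≤a+l = fromℕ< j-a< , Finₚ.toℕ-injective
      (trans (toℕ-index _) (trans (cong (a ℕ.+_) (Finₚ.toℕ-fromℕ< j-a<)) (ℕₚ.m+[n∸m]≡n a≤j)))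
      where
      j-a< : toℕ j ℕ.∸ a ℕ.< length segmentWord
      j-a< = subst (toℕ j ℕ.∸ a ℕ.<_) (sym length-segmentWord)
        (s≤s (subst (toℕ j ℕ.∸ a ℕ.≤_) (ℕₚ.m+n∸m≡n a l) (ℕₚ.∸-monoˡ-≤ a j≤a+l)))

    segment-follows : (∀ i → a ℕ.≤ toℕ i → Side (f (toℕ i)) p (r i)) →
      (∀ i → a ℕ.≤ toℕ i → Side (f (suc (toℕ i))) p (r i)) →
      Follows (letter segment) p (r ∘ index)
    segment-follows s₁ s₂ = follows-segment a
      (λ {i} i≤ → segment-letters i (s≤s (subst (i ℕ.≤_) length-segmentWord i≤))) toℕ-index
      (λ {i} → s₁ (index i) (a≤index i)) (λ {i} → s₂ (index i) (a≤index i))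
      (λ {i} i< → F.bends
        (s≤s (ℕₚ.≤-trans (ℕₚ.+-monoʳ-≤ a (ℕ.s≤s⁻¹ (subst (i ℕ.<_) length-segmentWord i<))) a+l≤k)))
      F
      where
      a≤index : ∀ i → a ℕ.≤ toℕ (index i)
      a≤index i = ℕₚ.≤-trans (ℕₚ.m≤m+n a (toℕ i)) (ℕₚ.≤-reflexive (sym (toℕ-index i)))

    origin-follows : Follows (letter segment) o (r ∘ index)
    origin-follows = segment-follows (λ i _ → F.origin₁ i) (λ i _ → F.origin₂ i)

    -- No pin of the segment comes directly after pin `j`, so none cuts it off from earlier points:
    -- seen from the segment, it is as good as the origin.
    pin-follows : ∀ j → suc (toℕ j) ℕ.< a → Follows (letter segment) (r j) (r ∘ index)
    pin-follows j j+1<a = segment-follows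
      (λ i a≤i → F.across (ℕₚ.<-≤-trans j+1<a a≤i))
      (λ i a≤i → F.outwards (ℕₚ.<-≤-trans (ℕₚ.<⇒≤ j+1<a) a≤i))

    length-segment : length segment ≡ 2 ℕ.+ l
    length-segment = length-applyUpTo letters (2 ℕ.+ l)

    segment-fits : a ℕ.+ (2 ℕ.+ l) ℕ.≤ length w
    segment-fits = subst₂ ℕ._≤_ (sym (shift-2 a l)) (sym |w|≡) (s≤s (s≤s a+l≤k))

    segment-factor : Factor segment w
    segment-factor = letters-factor segment w a
      (subst (λ n → a ℕ.+ n ℕ.≤ length w) (sym length-segment) segment-fits)
      (λ i i< → segment-letters i (subst (i ℕ.<_) length-segment i<))

  module _ {π : Perm} {h : Fin ∣ π ∣ → Fin (suc k)} (same : SameOrder (diagram π) (r ∘ h)) where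
    private
      h-injective : Injective _≡_ _≡_ h
      h-injective = sameOrder-injective {π = π} {r} h same

    -- The pins of `π` are exactly those of the segment, seen from `o`. A strict word has at least
    -- one direction, which is where `l ≢ 0` enters.
    run⇒E : ∀ a l (a+l≤k : a ℕ.+ l ℕ.≤ k) → l ≢ 0 →
      (∀ z → a ℕ.≤ toℕ (h z) × toℕ (h z) ℕ.≤ a ℕ.+ l) →
      (∀ {m} → a ℕ.≤ m → m ℕ.≤ a ℕ.+ l → ∃ λ z → toℕ (h z) ≡ m) →
      ∃ λ v → E π v × Factor v w
    run⇒E a l a+l≤k l≢0 h∈ run = segment ,
      inj₁ (segmentWord , strict-applyUpTo _ l≢0 ,
        correspondsTo {π = π}
          (orderIsomorphic-range {π = π} {r = r} index h index-injective h-injective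
            (λ i → let z , eq = run
                         (ℕₚ.≤-trans (ℕₚ.m≤m+n a _) (ℕₚ.≤-reflexive (sym (toℕ-index i))))
                         (ℕₚ.≤-trans (ℕₚ.≤-reflexive (toℕ-index i)) (ℕₚ.+-monoʳ-≤ a (index≤ i)))
                   in z , Finₚ.toℕ-injective eq)
            (λ z → index-onto (h z) (proj₁ (h∈ z)) (proj₂ (h∈ z)))
            (λ _ → refl) same)
          (∷-distinct (follows-apart origin-follows) (follows-distinct origin-follows))
          -- `follows⇒placed` wants two points before the pins; the origin is taken for both and one
          -- copy is dropped.
          (λ i → placed-tail (lookup segmentWord i) (suc i)
            (follows⇒placed (proj₂ head-corner) origin-follows origin-follows i)) ,
        φ-segment) ,
      segment-factor
      where open Segment a l a+l≤k

    -- The gap between the isolated pin and the run forces `a` to be at least 2, so two letters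
    -- precede the segment and supply the turn `t`.
    point+run⇒E : ∀ a l (a+l≤k : a ℕ.+ l ℕ.≤ k) z₀ → suc (toℕ (h z₀)) ℕ.< a →
      (∀ z → z ≡ z₀ ⊎ a ℕ.≤ toℕ (h z) × toℕ (h z) ℕ.≤ a ℕ.+ l) →
      (∀ {m} → a ℕ.≤ m → m ℕ.≤ a ℕ.+ l → ∃ λ z → toℕ (h z) ≡ m) →
      ∃ λ v → E π v × Factor v w
    point+run⇒E (suc zero) _ _ _ (s≤s ())
    point+run⇒E (suc (suc a)) l a+l≤k z₀ h₀<a h∈ run = t ++ segment ,
      inj₂ ((s≤s (s≤s (s≤s z≤n)) , d∦e ∷ e∦v ∷ segment-alternating) ,
        num m₀ ∷ segmentWord , quasiStrict _ _ _ ,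
        correspondsTo {π = π}
          (orderIsomorphic-range {π = π} {r = r} (h z₀ Vector.∷ index) h index⁺-injective h-injective
            index⁺⊆h h⊆index⁺ (λ { zero → refl ; (suc _) → refl }) same)
          (∷-distinct apart₀ (∷-distinct (follows-apart pin₀-follows) (follows-distinct pin₀-follows)))
          placed⁺ ,
        t , segment , pair⇒turn _ _ d∦e , φ-segment , refl) ,
      letters-factor (t ++ segment) w a
        (subst (λ n → a ℕ.+ (2 ℕ.+ n) ℕ.≤ length w) (sym length-segment)
          (subst (ℕ._≤ length w) (sym (shift-2 a _)) segment-fits))
        letters⁺
      where
      open Segment (2 ℕ.+ a) l a+l≤k
      t : Word
      t = f a ∷ f (suc a) ∷ []
      a≤k : a ℕ.≤ k
      a≤k = ℕₚ.≤-trans (ℕₚ.n≤1+n a) (ℕₚ.≤-trans (ℕₚ.n≤1+n (suc a)) (ℕₚ.m+n≤o⇒m≤o (2 ℕ.+ a) a+l≤k))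
      d∦e : axis (f a) ≢ axis (f (suc a))
      d∦e = F.bends (s≤s a≤k)
      e∦v : axis (f (suc a)) ≢ axis (f (2 ℕ.+ a))
      e∦v = F.bends (s≤s (ℕₚ.≤-trans (ℕₚ.n≤1+n (suc a)) (ℕₚ.m+n≤o⇒m≤o (2 ℕ.+ a) a+l≤k)))
      -- The leading numeral is the quadrant of the isolated pin about `o`.
      m₀ : Numeral
      m₀ = proj₁ (corner (F.turn (h z₀)))
      pin₀-follows : Follows (letter segment) (r (h z₀)) (r ∘ index)
      pin₀-follows = pin-follows (h z₀) h₀<a
      apart₀ : ∀ i → Apart o ((r (h z₀) Vector.∷ (r ∘ index)) i)
      apart₀ zero    = follows-apart F (h z₀)
      apart₀ (suc i) = follows-apart F (index i)
      placed⁺ : ∀ i → Placed (lookup (num m₀ ∷ segmentWord) i) (o Vector.∷ r (h z₀) Vector.∷ (r ∘ index)) (suc i)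
      placed⁺ zero    = placed₀
        where
        placed₀ : Placed (num m₀) (o Vector.∷ r (h z₀) Vector.∷ (r ∘ index)) (suc zero)
        placed₀ {zero} _ = sides-corner (proj₂ (corner (F.turn (h z₀)))) (F.origin₁ (h z₀)) (F.origin₂ (h z₀))
        placed₀ {suc _} (s≤s ())
      placed⁺ (suc i) = follows⇒placed (proj₂ head-corner) pin₀-follows origin-follows i
      h₀≢index : ∀ i → h z₀ ≢ index i
      h₀≢index i eq = ℕₚ.<-irrefl (trans (cong toℕ eq) (toℕ-index i))
        (ℕₚ.<-≤-trans (ℕₚ.<⇒≤ h₀<a) (ℕₚ.m≤m+n _ (toℕ i)))
      index⁺-injective : Injective _≡_ _≡_ (h z₀ Vector.∷ index)
      index⁺-injective {zero}  {zero}  _  = refl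
      index⁺-injective {zero}  {suc j} eq = contradiction eq (h₀≢index j)
      index⁺-injective {suc i} {zero}  eq = contradiction (sym eq) (h₀≢index i)
      index⁺-injective {suc i} {suc j} eq = cong suc (index-injective eq)
      index⁺⊆h : ∀ i → ∃ λ z → h z ≡ (h z₀ Vector.∷ index) i
      index⁺⊆h zero    = z₀ , refl
      index⁺⊆h (suc i) with run
        (ℕₚ.≤-trans (ℕₚ.m≤m+n (2 ℕ.+ a) _) (ℕₚ.≤-reflexive (sym (toℕ-index i))))
        (ℕₚ.≤-trans (ℕₚ.≤-reflexive (toℕ-index i)) (ℕₚ.+-monoʳ-≤ (2 ℕ.+ a) (index≤ i)))
      ... | z , eq = z , Finₚ.toℕ-injective eq
      h⊆index⁺ : ∀ z → ∃ λ i → (h z₀ Vector.∷ index) i ≡ h z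
      h⊆index⁺ z with h∈ z
      ... | inj₁ refl = zero , refl
      ... | inj₂ (a≤ , ≤b) with index-onto (h z) a≤ ≤b
      ... | i , eq = suc i , eq
      letters⁺ : ∀ i → i ℕ.< length (t ++ segment) → letter (t ++ segment) i ≡ f (a ℕ.+ i)
      letters⁺ zero          _              = cong f (sym (ℕₚ.+-identityʳ a))
      letters⁺ (suc zero)    _              = cong f (ℕₚ.+-comm 1 a)
      letters⁺ (suc (suc i)) (s≤s (s≤s i<)) = trans (segment-letters i (subst (i ℕ.<_) length-segment i<))
        (cong f (sym (shift-2 a i)))

    private
      Q : Pred ℕ 0ℓ
      Q m = ∃ λ z → toℕ (h z) ≡ m

      Q? : Decidable Q
      Q? m = Finₚ.any? λ z → toℕ (h z) ℕₚ.≟ m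

      Q< : ∀ {m} → Q m → m ℕ.< suc k
      Q< (z , refl) = Finₚ.toℕ<n (h z)

    -- `T` collects the points placed before the last run, which begins after a gap. Simplicity
    -- leaves `T` empty, giving a strict word, or with a single point, giving a quasi-strict one.
    last-run⇒E : Simple π → ∣ π ∣ ≢ 1 → ∀ {a b} z → toℕ (h z) ≡ b → (∀ {m} → Q m → m ℕ.≤ b) →
      a ℕ.≤ b → (∀ {m} → a ℕ.≤ m → m ℕ.≤ b → Q m) → (∀ {m} → suc m ≡ a → ¬ Q m) →
      ∃ λ v → E π v × Factor v w
    last-run⇒E simple |π|≢1 {a} {b} z-last last≡b ≤b a≤b run ¬Q = by-cases (Finₚ.any? T?)
      where
      T : Pred (Fin ∣ π ∣) 0ℓ
      T z = toℕ (h z) ℕ.< a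
      T? : Decidable T
      T? z = toℕ (h z) ℕₚ.<? a
      gap : ∀ {z} → T z → suc (toℕ (h z)) ℕ.< a
      gap {z} Tz = ℕₚ.≤∧≢⇒< Tz λ eq → ¬Q eq (z , refl)
      ¬T-last : ¬ T z-last
      ¬T-last T-last = ℕₚ.<⇒≱ T-last (subst (a ℕ.≤_) (sym last≡b) a≤b)
      -- The pins before a gap lie on the same sides of every pin after it.
      uncut : ∀ {z i j} → ¬ T z → T i → T j →
        (z Fin.< i → z Fin.< j) × ((π at z) Fin.< (π at i) → (π at z) Fin.< (π at j))
      uncut {z} {i} {j} ¬Tz Ti Tj =
        (λ lt → ℤₚ.drop‿+<+ (to (proj₁ agree′) (ℤ.+<+ lt))) ,
        (λ lt → ℤₚ.drop‿+<+ (to (proj₂ agree′) (ℤ.+<+ lt)))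
        where
        open Equivalence
        before : ∀ {i} → T i → suc (toℕ (h i)) ℕ.< toℕ (h z)
        before Ti = ℕₚ.<-≤-trans (gap Ti) (ℕₚ.≮⇒≥ ¬Tz)
        agree′ : Agree (diagram π z) (diagram π i) (diagram π z) (diagram π j)
        agree′ = agree-trans (same z i) (agree-trans
          (proj₂ (agree (F.turn (h z)) (F.across (before Ti)) (F.across (before Tj))
            (F.outwards (ℕₚ.<⇒≤ (before Ti))) (F.outwards (ℕₚ.<⇒≤ (before Tj)))))
          (agree-sym (same z j)))
      l≡ : a ℕ.+ (b ℕ.∸ a) ≡ b
      l≡ = ℕₚ.m+[n∸m]≡n a≤b
      a+l≤k : a ℕ.+ (b ℕ.∸ a) ℕ.≤ k
      a+l≤k = subst (ℕ._≤ k) (sym l≡) (subst (ℕ._≤ k) last≡b (ℕ.s≤s⁻¹ (Finₚ.toℕ<n (h z-last))))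
      ≤a+l : ∀ z → toℕ (h z) ℕ.≤ a ℕ.+ (b ℕ.∸ a)
      ≤a+l z = subst (toℕ (h z) ℕ.≤_) (sym l≡) (≤b (z , refl))
      run′ : ∀ {m} → a ℕ.≤ m → m ℕ.≤ a ℕ.+ (b ℕ.∸ a) → ∃ λ z → toℕ (h z) ≡ m
      run′ a≤m m≤ = run a≤m (subst (_ ℕ.≤_) l≡ m≤)
      by-cases : Dec (∃ T) → ∃ λ v → E π v × Factor v w
      by-cases (no ∄T) = run⇒E a (b ℕ.∸ a) a+l≤k l≢0 (λ z → a≤ z , ≤a+l z) run′
        where
        a≤ : ∀ z → a ℕ.≤ toℕ (h z)
        a≤ z = ℕₚ.≮⇒≥ λ Tz → ∄T (z , Tz)
        -- A run of one pin with nothing before it would make `π` a one-point permutation.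
        l≢0 : b ℕ.∸ a ≢ 0
        l≢0 l≡0 = |π|≢1 (one-point h-injective λ z → ℕₚ.≤-antisym
          (subst (toℕ (h z) ℕ.≤_) (trans (cong (a ℕ.+_) l≡0) (ℕₚ.+-identityʳ a)) (≤a+l z)) (a≤ z))
          where
          one-point : ∀ {n} {h : Fin (suc n) → Fin (suc k)} → Injective _≡_ _≡_ h →
            (∀ z → toℕ (h z) ≡ a) → suc n ≡ 1
          one-point {zero}  _   _   = refl
          one-point {suc n} inj h≡a with () ←
            inj {zero} {suc zero} (Finₚ.toℕ-injective (trans (h≡a _) (sym (h≡a _))))
      by-cases (yes (z₀ , Tz₀)) = point+run⇒E a (b ℕ.∸ a) a+l≤k z₀ (gap Tz₀) only run′
        where
        only : ∀ z → z ≡ z₀ ⊎ a ℕ.≤ toℕ (h z) × toℕ (h z) ℕ.≤ a ℕ.+ (b ℕ.∸ a)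
        only z with T? z
        ... | no ¬Tz = inj₂ (ℕₚ.≮⇒≥ ¬Tz , ≤a+l z)
        ... | yes Tz with Finₚ.<-cmp z z₀
        ... | tri≈ _ z≡z₀ _ = inj₁ z≡z₀
        -- Two points of `T` would make it a block and force the last pin into it.
        ... | tri< z<z₀ _ _ = contradiction (simple⇒no-block {π} simple T? uncut z<z₀ Tz Tz₀) ¬T-last
        ... | tri> _ _ z₀<z = contradiction (simple⇒no-block {π} simple T? uncut z₀<z Tz₀ Tz) ¬T-last

    simple⇒E : Simple π → ∣ π ∣ ≢ 1 → ∃ λ v → E π v × Factor v w
    simple⇒E simple |π|≢1 = from-maximum (maximum Q? (suc k) Q< (_ , zero , refl))
      where
      from-maximum : (∃ λ b → Q b × (∀ {m} → Q m → m ℕ.≤ b)) → ∃ λ v → E π v × Factor v w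
      from-maximum (b , (z , hz≡b) , ≤b) with run-start Q? b (z , hz≡b)
      ... | a , a≤b , run , ¬Q = last-run⇒E simple |π|≢1 z hz≡b ≤b a≤b run ¬Q

-- From words without forbidden factors to pin-permutations.

one-point-≼ : ∀ {π} α → ∣ π ∣ ≡ 1 → π ≼ α
one-point-≼ {zero , ρ} α refl = (λ _ → zero) , (λ { {zero} {zero} () }) ,
  λ { zero zero → mk⇔ (λ lt → contradiction lt (ℕₚ.<-irrefl refl))
                    (λ lt → contradiction lt (ℕₚ.<-irrefl {toℕ (α at zero)} refl)) }

-- Only a one-point pattern escapes simple⇒E, and it lies in every permutation.
free⇒avoids : ∀ {ℓ} {B : Pred Perm ℓ} → B ⊆ Simple → Satisfiable (Av B) →
  length w ≡ suc (suc k) → HasNoFactorIn (Forbidden B) w →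
  {r : Fin (suc k) → Pin} → Follows (letter w) o r →
  ∀ {σ} → OrderIsomorphic r (diagram σ) → Av B σ
free⇒avoids {w} {k} {B = B} B⊆Simple (α , α-avoids) |w|≡ free {r} F {σ} (τ , r≅σ) π Bπ (g , g-mono , g-values) =
  not-free (simple⇒E |w|≡ F {π} {h} same (B⊆Simple Bπ) λ |π|≡1 → α-avoids π Bπ (one-point-≼ {π} α |π|≡1))
  where
  open Equivalence

  not-free : ¬ (∃ λ v → E π v × Factor v w)
  not-free (v , Eπv , v-factor) = free v (inj₁ (π , Bπ , Eπv)) v-factor

  h : Fin ∣ π ∣ → Fin (suc k)
  h z = τ ⟨$⟩ˡ g z

  g-cancel : ∀ {i j} → g i Fin.< g j → i Fin.< j
  g-cancel {i} {j} gi<gj with Finₚ.<-cmp i j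
  ... | tri< i<j _ _  = i<j
  ... | tri≈ _ refl _ = contradiction gi<gj (ℕₚ.<-irrefl refl)
  ... | tri> _ _ j<i  = contradiction gi<gj (ℕₚ.<-asym (g-mono j<i))

  same : SameOrder (diagram π) (r ∘ h)
  same i j = agree-trans
    (mk⇔ (λ { (ℤ.+<+ lt) → ℤ.+<+ (g-mono lt) }) (λ { (ℤ.+<+ lt) → ℤ.+<+ (g-cancel lt) }) ,
     mk⇔ (λ { (ℤ.+<+ lt) → ℤ.+<+ (to (g-values i j) lt) }) (λ { (ℤ.+<+ lt) → ℤ.+<+ (from (g-values i j) lt) }))
    (agree-sym (subst₂ (λ i′ j′ → Agree (r (h i)) (r (h j)) (diagram σ i′) (diagram σ j′))
      (inverseʳ τ) (inverseʳ τ) (r≅σ (h i) (h j))))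

free⇒bends : ∀ {ℓ} {B : Pred Perm ℓ} → HasNoFactorIn (Forbidden B) w →
  ∀ {i} → suc i ℕ.< length w → axis (letter w i) ≢ axis (letter w (suc i))
free⇒bends {w} free {i} i< d∥e = free _ (inj₂ (pair⇒nonTurn (letter w i) (letter w (suc i)) d∥e))
  (letters-factor _ w i (ℕₚ.≤-trans (ℕₚ.≤-reflexive (ℕₚ.+-comm i 2)) i<) λ where
    zero          _ → cong (letter w) (sym (ℕₚ.+-identityʳ i))
    (suc zero)    _ → cong (letter w) (ℕₚ.+-comm 1 i)
    (suc (suc _)) (s≤s (s≤s ())))

unbounded-pin-permutations : ∀ {ℓ} {B : Pred Perm ℓ} → B ⊆ Simple → Satisfiable (Av B) →
  ArbitrarilyLong length (HasNoFactorIn (Forbidden B)) → ArbitrarilyLong ∣_∣ (Av B ∩ ProperPinPermutation)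
-- At least two letters are needed: a word has one letter more than it places pins, and permutations
-- are nonempty.
unbounded-pin-permutations {B = B} B⊆Simple nonempty words N = from-word (words (2 ℕ.+ N))
  where
  from-pins : ∀ {k w} {r : Fin (suc k) → Pin} → length w ≡ suc (suc k) →
    HasNoFactorIn (Forbidden B) w → Follows (letter w) origin r →
    (∃ λ ρ → OrderIsomorphic r (diagram (k , ρ))) →
    ∃ λ σ → suc k ℕ.≤ ∣ σ ∣ × Av B σ × ProperPinPermutation σ
  from-pins {k} |w|≡ free F (ρ , r≅σ) = (k , ρ) , ℕₚ.≤-refl ,
    free⇒avoids B⊆Simple nonempty |w|≡ free F {k , ρ} r≅σ ,
    _ , (proj₁ (follows⇒pinSequence F) , r≅σ) , proj₂ (follows⇒pinSequence F)

  from-word : (∃ λ w → 2 ℕ.+ N ℕ.≤ length w × HasNoFactorIn (Forbidden B) w) →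
    ∃ λ σ → N ℕ.≤ ∣ σ ∣ × Av B σ × ProperPinPermutation σ
  from-word (w@(_ ∷ _ ∷ _) , s≤s (s≤s N≤) , free) =
    map₂ (map₁ (ℕₚ.≤-trans (ℕₚ.m≤n⇒m≤1+n N≤)))
      (from-pins {w = w} refl free F (permutation-of-pins _ (follows-distinct F)))
    where
    F : Follows (letter w) origin (spiral (letter w) ∘ toℕ)
    F = spiral-follows (letter w) (free⇒bends free ∘ s≤s)

theorem3 : ∀ {ℓ : Level} (B : Pred Perm ℓ) → B ⊆ Simple → Satisfiable (Av B) →
    ArbitrarilyLong ∣_∣ (Av B ∩ ProperPinPermutation)
    ⇔ ArbitrarilyLong length (HasNoFactorIn (Forbidden B))
theorem3 B B⊆Simple nonempty = mk⇔ unbounded-words (unbounded-pin-permutations B⊆Simple nonempty)
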